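{- If the Minimum Circuit Size Problem on inputs of length $N$ can be computed by some function in ${\sf FORMULA}[s]\circ{\sf XOR}$ (on $N$ input bits), then $s=\tilde\Omega(N^2)$, i.e. $s\ge N^2/\mathrm{polylog}(N)$.
   Context: A de Morgan formula is a rooted tree whose internal gates are AND, OR (fan-in 2) and NOT (fan-in 1) and whose leaves are labelled by inputs; its size is the number of leaves. ${\sf FORMULA}[s]\circ{\sf XOR}$ is the class of functions $F(g_1(x),\dots,g_s(x))$ where $F$ is a de Morgan formula of size at most $s$ and each $g_i$ is a parity function $x\mapsto\bigoplus_{i\in S}x_i$ or its negation. Minimum Circuit Size Problem (MCSP): the input (of total length $N$, in a fixed encoding) consists of the truth table of a function $f\colon\{0,1\}^{\log n}\to\{0,1\}$ (an $n$-bit string) and a string $1^\ell$; the answer is $1$ iff $f$ has Boolean circuit complexity at most $\ell$. -}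

module Defs where

open import Data.Bool.Base using (Bool; true; false; _∧_; _∨_; not; _xor_)
open import Data.Fin.Base using (Fin; funToFin)
open import Data.Fin.Properties using (2↔Bool)
open import Data.Fin.Subset using (Subset; _∩_)
open import Data.List.Base as List using (List; _++_)
open import Data.Nat.Base using (ℕ; zero; suc; _+_; _^_; _≤_)
open import Data.Product.Base using (Σ-syntax; ∃-syntax; _×_)
open import Data.Vec.Base as Vec using (Vec; []; _∷_; lookup; toList; foldr′)
open import Function.Base using (_∘_)
open import Function.Bundles using (_⇔_; Inverse)
open import Relation.Binary.PropositionalEquality.Core using (_≡_)

------------------------------------------------------------------------
-- De Morgan formulas over parities

data Formula (n : ℕ) : Set where
  leaf   : Fin n → Formula n
  and or : Formula n → Formula n → Formula n
  neg    : Formula n → Formula n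

size : ∀ {n} → Formula n → ℕ
size (leaf _)  = 1
size (and F G) = size F + size G
size (or F G)  = size F + size G
size (neg F)   = size F

evalFormula : ∀ {n} → Formula n → (Fin n → Bool) → Bool
evalFormula (leaf i)  y = y i
evalFormula (and F G) y = evalFormula F y ∧ evalFormula G y
evalFormula (or F G)  y = evalFormula F y ∨ evalFormula G y
evalFormula (neg F)   y = not (evalFormula F y)

record ParityGate (N : ℕ) : Set where
  field
    support : Subset N
    negated : Bool

-- A bit string is itself a subset of its positions, so  support ∩ x  keeps
-- exactly the bits of x that lie in the support.
evalParity : ∀ {N} → ParityGate N → Vec Bool N → Bool
evalParity g x = negated xor foldr′ _xor_ false (support ∩ x)
  where open ParityGate g

FORMULA[_]∘XOR : ℕ → ∀ {N} → (Vec Bool N → Bool) → Set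
FORMULA[ s ]∘XOR {N} φ =
  Σ[ F ∈ Formula s ] Σ[ g ∈ (Fin s → ParityGate N) ]
    (size F ≤ s × (∀ x → φ x ≡ evalFormula F (λ i → evalParity (g i) x)))

------------------------------------------------------------------------
-- Boolean circuits: fan-in two AND and OR, and NOT.  The size is the number
-- of gates; input variables and the two constants are free.

-- What a gate may read when k variables and m earlier gates are available.
data Wire (k m : ℕ) : Set where
  input : Fin k → Wire k m
  const : Bool → Wire k m
  gate  : Fin m → Wire k m

data Gate (k m : ℕ) : Set where
  and or : Wire k m → Wire k m → Gate k m
  neg    : Wire k m → Gate k m

-- Gates in topological order; the newest gate always has index zero.
data Gates (k : ℕ) : ℕ → Set where
  []  : Gates k 0
  _▷_ : ∀ {m} → Gates k m → Gate k m → Gates k (suc m)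

infixl 5 _▷_

record Circuit (k m : ℕ) : Set where
  field
    gates  : Gates k m
    output : Wire k m

module _ {k : ℕ} (x : Fin k → Bool) where

  evalWire : ∀ {m} → Vec Bool m → Wire k m → Bool
  evalWire vs (input i) = x i
  evalWire vs (const b) = b
  evalWire vs (gate j)  = lookup vs j

  evalGate : ∀ {m} → Vec Bool m → Gate k m → Bool
  evalGate vs (and u v) = evalWire vs u ∧ evalWire vs v
  evalGate vs (or u v)  = evalWire vs u ∨ evalWire vs v
  evalGate vs (neg u)   = not (evalWire vs u)

  evalGates : ∀ {m} → Gates k m → Vec Bool m
  evalGates []       = []
  evalGates (gs ▷ g) = evalGate (evalGates gs) g ∷ evalGates gs

evalCircuit : ∀ {k m} → Circuit k m → (Fin k → Bool) → Bool
evalCircuit C x = evalWire x (evalGates x gates) output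
  where open Circuit C

CircuitComplexity≤ : ∀ {k} → ((Fin k → Bool) → Bool) → ℕ → Set
CircuitComplexity≤ {k} f ℓ =
  ∃[ m ] (m ≤ ℓ × Σ[ C ∈ Circuit k m ] (∀ x → evalCircuit C x ≡ f x))

------------------------------------------------------------------------
-- The Minimum Circuit Size Problem

-- Truth tables list the values in lexicographic order of the arguments, with
-- false < true and coordinate zero most significant.
fromTruthTable : ∀ k → Vec Bool (2 ^ k) → (Fin k → Bool) → Bool
fromTruthTable k tt x = lookup tt (funToFin (Inverse.from 2↔Bool ∘ x))

-- The encoding of an instance (tt , 1^ℓ) with n = 2 ^ k is the string
-- 1^k 0 tt 1^ℓ 0^p.  The prefix 1^k 0 announces n, so the instance can be
-- read off from the string.  The padding 0^p, of arbitrary length, makes each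
-- instance available at all sufficiently large input lengths N.  Without it
-- N and n would determine ℓ, and at infinitely many lengths all the instances
-- would be trivial because ℓ exceeds every circuit complexity.
encode : ∀ k → Vec Bool (2 ^ k) → (ℓ p : ℕ) → List Bool
encode k tt ℓ p =
  List.replicate k true ++ false List.∷ toList tt
    ++ List.replicate ℓ true ++ List.replicate p false

-- Nothing is required of φ on strings that encode no instance.
ComputesMCSP : ∀ {N} → (Vec Bool N → Bool) → Set
ComputesMCSP {N} φ =
  ∀ (y : Vec Bool N) k (tt : Vec Bool (2 ^ k)) ℓ p →
  toList y ≡ encode k tt ℓ p →
  φ y ≡ true ⇔ CircuitComplexity≤ (fromTruthTable k tt) ℓ

{-# OPTIONS --safe #-}
module Submission where

-- An adversary-matrix bound in the spirit of Khrapchenko.  Let S be the set of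
-- parities read by the formula F, let n be the length of the truth tables, and
-- let R be a multiset of easy truth tables for which the characters χ t, with t
-- a sum of at most d elements of S, are pairwise orthogonal.  With
-- w t = max (0 , d − dist t), where dist t is the least number of elements of S
-- with sum t, consider the matrix K = ∑ₜ w t · χ t ⊗ χ t on R × {0,1}ⁿ.  On a
-- rectangle separated by a parity s ∈ S, translation by s changes the sign of
-- χ t ⊗ χ t and changes w t by at most 1, so that Bessel's inequality bounds the
-- sum of K over that rectangle.  Adding up over the rectangles of the
-- Karchmer–Wigderson protocol of F by Cauchy–Schwarz, the sum of K over
-- F⁻¹(1) × F⁻¹(0) is at most √(size F) times the bound for one rectangle.  Since
-- F accepts R and rejects most tables, that sum is also at least d times as
-- large as the bound, up to a constant, whence size F ≥ 2 d².
--
-- The multiset R depends on F.  It consists of the sums of b tables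
-- z ↦ ⟨r , v z⟩, where v z is the result of applying to a fixed vector those of
-- k matrices over F₂ that are selected by the bits of z.  For a given u ≢ 𝟘, the
-- sum of u z · v z over all z vanishes for random matrices with probability
-- exponentially small in their dimension, so the matrices can be chosen
-- greedily, and b = O(d log size F) summands handle all the sums of 2d elements
-- of S.  All of R then has circuits of size d · polylog n, which is below the
-- complexity of most tables for some d = n / polylog n.

open import Defs
open import Data.Bool.Base using (Bool; true; false; _∧_; _∨_; not; _xor_; if_then_else_)
open import Data.Bool.Properties as Boolₚ using (not-involutive; not-injective; xor-assoc; xor-comm; xor-same; xor-identityʳ; ∧-distribˡ-xor; ∧-distribʳ-xor; true-xor; if-float)
open import Data.Empty using (⊥-elim)
open import Data.Fin.Base using (Fin; zero; suc; funToFin; finToFun; combine; _↑ˡ_)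
open import Data.Fin.Properties using (2↔Bool; funToFin-finToFin)
open import Data.Fin.Subset using (_∩_)
open import Data.Integer.Base using (ℤ; +_; -[1+_]; 0ℤ; 1ℤ; -1ℤ; +≤+) renaming (_+_ to _+ᶻ_; _*_ to _*ᶻ_; _-_ to _-ᶻ_; -_ to -ᶻ_; _≤_ to _≤ᶻ_)
open import Data.Integer.Properties as ℤₚ using ()
open import Data.Integer.Tactic.RingSolver using (solve-∀)
open import Data.List.Base as List using (List; []; _∷_; _++_; length; cartesianProductWith)
open import Data.List.Membership.Propositional using (_∈_)
open import Data.List.Membership.Propositional.Properties using (∈-cartesianProductWith⁺; ∈-cartesianProductWith⁻; ∈-tabulate⁺; ∈-map⁺; ∈-map⁻; ∈-++⁺ˡ; ∈-++⁺ʳ; ∈-allFin)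
open import Data.List.Properties using (length-++; length-map; length-tabulate)
open import Data.List.Relation.Unary.All as All using (All; []; _∷_)
open import Data.List.Relation.Unary.Any using (here; there; any?)
open import Data.Nat.Base using (ℕ; zero; suc; z≤n; s≤s; _≤_; _<_; _+_; _*_; _∸_; _^_; _/_; _%_; NonZero; >-nonZero)
open import Data.Nat.DivMod using (m≡m%n+[m/n]*n; m%n<n; m/n*n≤m)
open import Data.Nat.Logarithm using (⌊log₂_⌋; ⌊log₂⌋-mono-≤; ⌊log₂[2^n]⌋≡n)
open import Data.Nat.Properties as ℕₚ using ()
open import Data.Nat.Tactic.RingSolver using () renaming (solve-∀ to solve-∀ℕ)
open import Data.Product.Base using (_,_; _×_; proj₁; proj₂; ∃-syntax; Σ-syntax)
open import Data.Sum.Base as Sum using (_⊎_; inj₁; inj₂)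
open import Data.Vec.Base as Vec using (Vec; []; _∷_; foldr′; head; lookup; replicate; tabulate; tail; take; drop; toList; zipWith)
open import Data.Vec.Properties using (≡-dec; lookup-++ˡ; lookup-++ʳ; lookup-map; lookup-replicate; lookup-zipWith; tabulate-cong; tabulate∘lookup; take++drop≡id; toList-++; toList-replicate; zipWith-assoc)
open import Data.Vec.Relation.Unary.All as Allᵥ using ([]; _∷_) renaming (All to Allᵥ)
open import Function.Base using (_∘_)
open import Function.Bundles using (Equivalence; Inverse; _⇔_)
open import Relation.Binary.PropositionalEquality using (_≡_; _≢_; refl; sym; trans; cong; cong₂; subst; subst₂; module ≡-Reasoning)
open import Relation.Nullary.Decidable using (Dec; does; yes; no; dec-true; dec-false)

-- Bit vectors as a vector space over F₂

infixl 6 _⊕_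
_⊕_ : ∀ {n} → Vec Bool n → Vec Bool n → Vec Bool n
_⊕_ = zipWith _xor_

𝟘 : ∀ {n} → Vec Bool n
𝟘 = replicate _ false

dot : ∀ {n} → Vec Bool n → Vec Bool n → Bool
dot u x = foldr′ _xor_ false (u ∩ x)

xor-medial : ∀ a b c d → (a xor b) xor (c xor d) ≡ (a xor c) xor (b xor d)
xor-medial false false c     d = refl
xor-medial false true  false d = refl
xor-medial false true  true  d = refl
xor-medial true  false false d = refl
xor-medial true  false true  d = not-involutive d
xor-medial true  true  false d = sym (not-involutive d)
xor-medial true  true  true  d = refl

xor-cancelʳ : ∀ a b → (a xor b) xor b ≡ a
xor-cancelʳ a b = trans (xor-assoc a b b) (trans (cong (a xor_) (xor-same b)) (xor-identityʳ a))

⊕-cancelʳ : ∀ {n} (u v : Vec Bool n) → (u ⊕ v) ⊕ v ≡ u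
⊕-cancelʳ []      []      = refl
⊕-cancelʳ (a ∷ u) (b ∷ v) = cong₂ _∷_ (xor-cancelʳ a b) (⊕-cancelʳ u v)

⊕-identityʳ : ∀ {n} (u : Vec Bool n) → u ⊕ 𝟘 ≡ u
⊕-identityʳ []      = refl
⊕-identityʳ (a ∷ u) = cong₂ _∷_ (xor-identityʳ a) (⊕-identityʳ u)

⊕-identityˡ : ∀ {n} (u : Vec Bool n) → 𝟘 ⊕ u ≡ u
⊕-identityˡ []      = refl
⊕-identityˡ (a ∷ u) = cong (a ∷_) (⊕-identityˡ u)

⊕≡𝟘⇒≡ : ∀ {n} (u v : Vec Bool n) → u ⊕ v ≡ 𝟘 → u ≡ v
⊕≡𝟘⇒≡ u v eq = trans (sym (⊕-cancelʳ u v)) (trans (cong (_⊕ v) eq) (⊕-identityˡ v))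

⊕-medial : ∀ {n} (s t u v : Vec Bool n) → (s ⊕ t) ⊕ (u ⊕ v) ≡ (s ⊕ u) ⊕ (t ⊕ v)
⊕-medial []      []      []      []      = refl
⊕-medial (a ∷ s) (b ∷ t) (c ∷ u) (d ∷ v) = cong₂ _∷_ (xor-medial a b c d) (⊕-medial s t u v)

dot-⊕ˡ : ∀ {n} (u v x : Vec Bool n) → dot (u ⊕ v) x ≡ dot u x xor dot v x
dot-⊕ˡ []      []      []      = refl
dot-⊕ˡ (a ∷ u) (b ∷ v) (c ∷ x) =
  trans (cong₂ _xor_ (∧-distribʳ-xor c a b) (dot-⊕ˡ u v x))
        (xor-medial (a ∧ c) (b ∧ c) (dot u x) (dot v x))

dot-⊕ʳ : ∀ {n} (u x y : Vec Bool n) → dot u (x ⊕ y) ≡ dot u x xor dot u y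
dot-⊕ʳ []      []      []      = refl
dot-⊕ʳ (a ∷ u) (b ∷ x) (c ∷ y) =
  trans (cong₂ _xor_ (∧-distribˡ-xor a b c) (dot-⊕ʳ u x y))
        (xor-medial (a ∧ b) (a ∧ c) (dot u x) (dot u y))

dot-𝟘ˡ : ∀ {n} (x : Vec Bool n) → dot 𝟘 x ≡ false
dot-𝟘ˡ []      = refl
dot-𝟘ˡ (_ ∷ x) = dot-𝟘ˡ x

dot-𝟘ʳ : ∀ {n} (u : Vec Bool n) → dot u 𝟘 ≡ false
dot-𝟘ʳ []          = refl
dot-𝟘ʳ (true ∷ u)  = dot-𝟘ʳ u
dot-𝟘ʳ (false ∷ u) = dot-𝟘ʳ u

-- Finite sums of integers

∑ : ∀ {I : Set} → List I → (I → ℤ) → ℤ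
∑ []       f = 0ℤ
∑ (i ∷ is) f = f i +ᶻ ∑ is f

module _ {I : Set} where

  ∑-cong : ∀ (is : List I) {f g : I → ℤ} → (∀ i → f i ≡ g i) → ∑ is f ≡ ∑ is g
  ∑-cong []       eq = refl
  ∑-cong (i ∷ is) eq = cong₂ _+ᶻ_ (eq i) (∑-cong is eq)

  ∑-zero : ∀ (is : List I) {f : I → ℤ} → (∀ i → f i ≡ 0ℤ) → ∑ is f ≡ 0ℤ
  ∑-zero []       eq = refl
  ∑-zero (i ∷ is) eq = cong₂ _+ᶻ_ (eq i) (∑-zero is eq)

  ∑-++ : ∀ (is js : List I) (f : I → ℤ) → ∑ (is ++ js) f ≡ ∑ is f +ᶻ ∑ js f
  ∑-++ []       js f = sym (ℤₚ.+-identityˡ _)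
  ∑-++ (i ∷ is) js f = trans (cong (f i +ᶻ_) (∑-++ is js f)) (sym (ℤₚ.+-assoc (f i) _ _))

  ∑-+ : ∀ (is : List I) (f g : I → ℤ) → ∑ is (λ i → f i +ᶻ g i) ≡ ∑ is f +ᶻ ∑ is g
  ∑-+ []       f g = refl
  ∑-+ (i ∷ is) f g = trans (cong (f i +ᶻ g i +ᶻ_) (∑-+ is f g)) (lemma (f i) (g i) _ _)
    where
    lemma : ∀ a b c d → a +ᶻ b +ᶻ (c +ᶻ d) ≡ (a +ᶻ c) +ᶻ (b +ᶻ d)
    lemma = solve-∀

  ∑-*ˡ : ∀ (is : List I) c (f : I → ℤ) → ∑ is (λ i → c *ᶻ f i) ≡ c *ᶻ ∑ is f
  ∑-*ˡ []       c f = sym (ℤₚ.*-zeroʳ c)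
  ∑-*ˡ (i ∷ is) c f = trans (cong (c *ᶻ f i +ᶻ_) (∑-*ˡ is c f)) (sym (ℤₚ.*-distribˡ-+ c (f i) _))

  ∑-*ʳ : ∀ (is : List I) c (f : I → ℤ) → ∑ is (λ i → f i *ᶻ c) ≡ ∑ is f *ᶻ c
  ∑-*ʳ is c f = trans (∑-cong is (λ i → ℤₚ.*-comm (f i) c)) (trans (∑-*ˡ is c f) (ℤₚ.*-comm c _))

  ∑-mono : ∀ (is : List I) {f g : I → ℤ} → (∀ i → f i ≤ᶻ g i) → ∑ is f ≤ᶻ ∑ is g
  ∑-mono []       le = ℤₚ.≤-refl
  ∑-mono (i ∷ is) le = ℤₚ.+-mono-≤ (le i) (∑-mono is le)

  ∑-nonneg : ∀ (is : List I) {f : I → ℤ} → (∀ i → 0ℤ ≤ᶻ f i) → 0ℤ ≤ᶻ ∑ is f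
  ∑-nonneg is nn = subst (_≤ᶻ ∑ is _) (∑-zero is {λ _ → 0ℤ} (λ _ → refl)) (∑-mono is {λ _ → 0ℤ} nn)

  ∑-const : ∀ (is : List I) c → ∑ is (λ _ → c) ≡ c *ᶻ + length is
  ∑-const []       c = sym (ℤₚ.*-zeroʳ c)
  ∑-const (i ∷ is) c = trans (cong (c +ᶻ_) (∑-const is c)) (sym (ℤₚ.*-suc c (+ length is)))

∑-map : ∀ {I J : Set} (h : J → I) (js : List J) (f : I → ℤ) → ∑ (List.map h js) f ≡ ∑ js (f ∘ h)
∑-map h []       f = refl
∑-map h (j ∷ js) f = cong (f (h j) +ᶻ_) (∑-map h js f)

∑-swap : ∀ {I J : Set} (is : List I) (js : List J) (f : I → J → ℤ) →
  ∑ is (λ i → ∑ js (f i)) ≡ ∑ js (λ j → ∑ is (λ i → f i j))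
∑-swap []       js f = sym (∑-zero js (λ _ → refl))
∑-swap (i ∷ is) js f =
  trans (cong (∑ js (f i) +ᶻ_) (∑-swap is js f)) (sym (∑-+ js (f i) _))

∑-product : ∀ {I J : Set} (is : List I) (js : List J) (f : I → ℤ) (g : J → ℤ) →
  ∑ is (λ i → ∑ js (λ j → f i *ᶻ g j)) ≡ ∑ is f *ᶻ ∑ js g
∑-product is js f g = trans (∑-cong is (λ i → ∑-*ˡ js (f i) g)) (∑-*ʳ is _ f)

square-nonneg : ∀ a → 0ℤ ≤ᶻ a *ᶻ a
square-nonneg (+ n)               = subst (0ℤ ≤ᶻ_) (ℤₚ.pos-* n n) (+≤+ z≤n)
square-nonneg -[1+ n ] = +≤+ z≤n

*-nonneg : ∀ {a b} → 0ℤ ≤ᶻ a → 0ℤ ≤ᶻ b → 0ℤ ≤ᶻ a *ᶻ b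
*-nonneg {+ a} {+ b} _ _ = subst (0ℤ ≤ᶻ_) (ℤₚ.pos-* a b) (+≤+ z≤n)

*-monoˡ-≤ᶻ : ∀ {a} b c → 0ℤ ≤ᶻ a → b ≤ᶻ c → a *ᶻ b ≤ᶻ a *ᶻ c
*-monoˡ-≤ᶻ {+ n} b c _ le = ℤₚ.*-monoˡ-≤-nonNeg (+ n) le

-- Lagrange's identity, summed over all pairs of indices.
cauchy-schwarz : ∀ {I : Set} (is : List I) (f g : I → ℤ) →
  ∑ is (λ i → f i *ᶻ g i) *ᶻ ∑ is (λ i → f i *ᶻ g i) ≤ᶻ
  ∑ is (λ i → f i *ᶻ f i) *ᶻ ∑ is (λ i → g i *ᶻ g i)
cauchy-schwarz is f g = ℤₚ.*-cancelˡ-≤-pos _ _ (+ 2) (ℤₚ.0≤i-j⇒j≤i (subst (0ℤ ≤ᶻ_) lagrange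
    (∑-nonneg is (λ i → ∑-nonneg is (λ j → square-nonneg (f i *ᶻ g j -ᶻ f j *ᶻ g i))))))
  where
  open ≡-Reasoning
  P Q R : ℤ
  P = ∑ is (λ i → f i *ᶻ f i)
  Q = ∑ is (λ i → g i *ᶻ g i)
  R = ∑ is (λ i → f i *ᶻ g i)
  expand : ∀ a b c d → (a *ᶻ b -ᶻ c *ᶻ d) *ᶻ (a *ᶻ b -ᶻ c *ᶻ d) ≡
    ((a *ᶻ a) *ᶻ (b *ᶻ b) +ᶻ (d *ᶻ d) *ᶻ (c *ᶻ c)) +ᶻ (-ᶻ + 2 *ᶻ (a *ᶻ d)) *ᶻ (c *ᶻ b)
  expand = solve-∀
  collect : ∀ P Q R → (P *ᶻ Q +ᶻ Q *ᶻ P) +ᶻ (-ᶻ + 2 *ᶻ R) *ᶻ R ≡ + 2 *ᶻ (P *ᶻ Q) -ᶻ + 2 *ᶻ (R *ᶻ R)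
  collect = solve-∀
  ∑-+₃ : ∀ a b c → ∑ is (λ i → (a i +ᶻ b i) +ᶻ c i) ≡ (∑ is a +ᶻ ∑ is b) +ᶻ ∑ is c
  ∑-+₃ a b c = trans (∑-+ is (λ i → a i +ᶻ b i) c) (cong (_+ᶻ ∑ is c) (∑-+ is a b))
  row : ∀ i → ∑ is (λ j → (f i *ᶻ g j -ᶻ f j *ᶻ g i) *ᶻ (f i *ᶻ g j -ᶻ f j *ᶻ g i)) ≡
              ((f i *ᶻ f i) *ᶻ Q +ᶻ (g i *ᶻ g i) *ᶻ P) +ᶻ (-ᶻ + 2 *ᶻ (f i *ᶻ g i)) *ᶻ R
  row i = begin
    ∑ is (λ j → (f i *ᶻ g j -ᶻ f j *ᶻ g i) *ᶻ (f i *ᶻ g j -ᶻ f j *ᶻ g i))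
      ≡⟨ ∑-cong is (λ j → expand (f i) (g j) (f j) (g i)) ⟩
    ∑ is (λ j → (f i *ᶻ f i *ᶻ (g j *ᶻ g j) +ᶻ g i *ᶻ g i *ᶻ (f j *ᶻ f j)) +ᶻ (-ᶻ + 2 *ᶻ (f i *ᶻ g i)) *ᶻ (f j *ᶻ g j))
      ≡⟨ ∑-+₃ (λ j → f i *ᶻ f i *ᶻ (g j *ᶻ g j)) (λ j → g i *ᶻ g i *ᶻ (f j *ᶻ f j)) (λ j → (-ᶻ + 2 *ᶻ (f i *ᶻ g i)) *ᶻ (f j *ᶻ g j)) ⟩
    (∑ is (λ j → f i *ᶻ f i *ᶻ (g j *ᶻ g j)) +ᶻ ∑ is (λ j → g i *ᶻ g i *ᶻ (f j *ᶻ f j))) +ᶻ ∑ is (λ j → (-ᶻ + 2 *ᶻ (f i *ᶻ g i)) *ᶻ (f j *ᶻ g j))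
      ≡⟨ cong₂ _+ᶻ_ (cong₂ _+ᶻ_ (∑-*ˡ is (f i *ᶻ f i) (λ j → g j *ᶻ g j)) (∑-*ˡ is (g i *ᶻ g i) (λ j → f j *ᶻ f j)))
                    (∑-*ˡ is (-ᶻ + 2 *ᶻ (f i *ᶻ g i)) (λ j → f j *ᶻ g j)) ⟩
    _ ∎
  lagrange : ∑ is (λ i → ∑ is (λ j → (f i *ᶻ g j -ᶻ f j *ᶻ g i) *ᶻ (f i *ᶻ g j -ᶻ f j *ᶻ g i))) ≡
             + 2 *ᶻ (P *ᶻ Q) -ᶻ + 2 *ᶻ (R *ᶻ R)
  lagrange = begin
    _ ≡⟨ ∑-cong is row ⟩
    ∑ is (λ i → ((f i *ᶻ f i) *ᶻ Q +ᶻ (g i *ᶻ g i) *ᶻ P) +ᶻ (-ᶻ + 2 *ᶻ (f i *ᶻ g i)) *ᶻ R)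
      ≡⟨ ∑-+₃ (λ i → (f i *ᶻ f i) *ᶻ Q) (λ i → (g i *ᶻ g i) *ᶻ P) (λ i → (-ᶻ + 2 *ᶻ (f i *ᶻ g i)) *ᶻ R) ⟩
    (∑ is (λ i → (f i *ᶻ f i) *ᶻ Q) +ᶻ ∑ is (λ i → (g i *ᶻ g i) *ᶻ P)) +ᶻ ∑ is (λ i → (-ᶻ + 2 *ᶻ (f i *ᶻ g i)) *ᶻ R)
      ≡⟨ cong₂ _+ᶻ_ (cong₂ _+ᶻ_ (∑-*ʳ is Q (λ i → f i *ᶻ f i)) (∑-*ʳ is P (λ i → g i *ᶻ g i)))
                    (trans (∑-*ʳ is R (λ i → -ᶻ + 2 *ᶻ (f i *ᶻ g i))) (cong (_*ᶻ R) (∑-*ˡ is (-ᶻ + 2) (λ i → f i *ᶻ g i)))) ⟩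
    (P *ᶻ Q +ᶻ Q *ᶻ P) +ᶻ (-ᶻ + 2 *ᶻ R) *ᶻ R
      ≡⟨ collect P Q R ⟩
    _ ∎

-- Characters of the cube

sgn : Bool → ℤ
sgn false = 1ℤ
sgn true  = -1ℤ

sgn-xor : ∀ a b → sgn (a xor b) ≡ sgn a *ᶻ sgn b
sgn-xor false b     = sym (ℤₚ.*-identityˡ (sgn b))
sgn-xor true  false = refl
sgn-xor true  true  = refl

χ : ∀ {n} → Vec Bool n → Vec Bool n → ℤ
χ u x = sgn (dot u x)

χ-⊕ˡ : ∀ {n} (u v x : Vec Bool n) → χ (u ⊕ v) x ≡ χ u x *ᶻ χ v x
χ-⊕ˡ u v x = trans (cong sgn (dot-⊕ˡ u v x)) (sgn-xor (dot u x) (dot v x))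

χ-⊕ʳ : ∀ {n} (u x y : Vec Bool n) → χ u (x ⊕ y) ≡ χ u x *ᶻ χ u y
χ-⊕ʳ u x y = trans (cong sgn (dot-⊕ʳ u x y)) (sgn-xor (dot u x) (dot u y))

χ-square : ∀ {n} (u x : Vec Bool n) → χ u x *ᶻ χ u x ≡ 1ℤ
χ-square u x with dot u x
... | true  = refl
... | false = refl

cube : ∀ n → List (Vec Bool n)
cube zero    = [] ∷ []
cube (suc n) = List.map (false ∷_) (cube n) ++ List.map (true ∷_) (cube n)

∑-cube-suc : ∀ n (f : Vec Bool (suc n) → ℤ) →
  ∑ (cube (suc n)) f ≡ ∑ (cube n) (f ∘ (false ∷_)) +ᶻ ∑ (cube n) (f ∘ (true ∷_))
∑-cube-suc n f =
  trans (∑-++ (List.map (false ∷_) (cube n)) _ f)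
        (cong₂ _+ᶻ_ (∑-map (false ∷_) (cube n) f) (∑-map (true ∷_) (cube n) f))

∑-cube-shift : ∀ {n} (s : Vec Bool n) (f : Vec Bool n → ℤ) →
  ∑ (cube n) (λ t → f (t ⊕ s)) ≡ ∑ (cube n) f
∑-cube-shift []      f = refl
∑-cube-shift {suc n} (b ∷ s) f =
  trans (∑-cube-suc n _)
    (trans (cong₂ _+ᶻ_ (∑-cube-shift s (λ t → f (b ∷ t))) (∑-cube-shift s (λ t → f (not b ∷ t))))
      (trans (swap b) (sym (∑-cube-suc n f))))
  where
  swap : ∀ b → ∑ (cube n) (λ t → f (b ∷ t)) +ᶻ ∑ (cube n) (λ t → f (not b ∷ t)) ≡
               ∑ (cube n) (f ∘ (false ∷_)) +ᶻ ∑ (cube n) (f ∘ (true ∷_))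
  swap false = refl
  swap true  = ℤₚ.+-comm (∑ (cube n) (f ∘ (true ∷_))) _

∑-cube-single : ∀ {n} (t : Vec Bool n) (f : Vec Bool n → ℤ) →
  (∀ u → t ≢ u → f u ≡ 0ℤ) → ∑ (cube n) f ≡ f t
∑-cube-single []      f off = ℤₚ.+-identityʳ (f [])
∑-cube-single {suc n} (false ∷ t) f off =
  trans (∑-cube-suc n f)
    (trans (cong₂ _+ᶻ_ (∑-cube-single t _ (λ u t≢u → off (false ∷ u) (λ { refl → t≢u refl })))
                       (∑-zero (cube n) (λ u → off (true ∷ u) (λ ()))))
           (ℤₚ.+-identityʳ _))
∑-cube-single {suc n} (true ∷ t) f off =
  trans (∑-cube-suc n f)
    (trans (cong₂ _+ᶻ_ (∑-zero (cube n) (λ u → off (false ∷ u) (λ ())))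
                       (∑-cube-single t _ (λ u t≢u → off (true ∷ u) (λ { refl → t≢u refl }))))
           (ℤₚ.+-identityˡ _))

-- Flipping the first coordinate at which `u` is true changes the sign of `χ u`, so the
-- contributions of the two values of that coordinate cancel.
∑-χ : ∀ {n} (u : Vec Bool n) → u ≢ 𝟘 → ∑ (cube n) (χ u) ≡ 0ℤ
∑-χ []      u≢𝟘 = ⊥-elim (u≢𝟘 refl)
∑-χ {suc n} (true ∷ u) u≢𝟘 = trans (∑-cube-suc n _) (trans (cong (∑ (cube n) (χ u) +ᶻ_)
    (trans (∑-cong (cube n) flip) (∑-*ˡ (cube n) -1ℤ (χ u)))) (cancel (∑ (cube n) (χ u))))
  where
  flip : ∀ x → χ (true ∷ u) (true ∷ x) ≡ -1ℤ *ᶻ χ u x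
  flip x = trans (cong sgn (true-xor (dot u x))) (sgn-xor true (dot u x))
  cancel : ∀ a → a +ᶻ -1ℤ *ᶻ a ≡ 0ℤ
  cancel = solve-∀
∑-χ {suc n} (false ∷ u) u≢𝟘 = trans (∑-cube-suc n _) (cong₂ _+ᶻ_ ih ih)
  where
  ih : ∑ (cube n) (χ u) ≡ 0ℤ
  ih = ∑-χ u (λ eq → u≢𝟘 (cong (false ∷_) eq))

𝟙 : Bool → ℕ
𝟙 true  = 1
𝟙 false = 0

𝟙-mono : ∀ {b c} → (b ≡ true → c ≡ true) → 𝟙 b ≤ 𝟙 c
𝟙-mono {false} _   = z≤n
𝟙-mono {true}  imp rewrite imp refl = ℕₚ.≤-refl

∧-split : ∀ {a b} → a ∧ b ≡ true → a ≡ true × b ≡ true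
∧-split {true} {true} _ = refl , refl

∨-split : ∀ {a b} → a ∨ b ≡ false → a ≡ false × b ≡ false
∨-split {false} {false} _ = refl , refl

⟦_⟧ : Bool → ℤ
⟦ true ⟧  = 1ℤ
⟦ false ⟧ = 0ℤ

⟦⟧-idem : ∀ b → ⟦ b ⟧ *ᶻ ⟦ b ⟧ ≡ ⟦ b ⟧
⟦⟧-idem true  = refl
⟦⟧-idem false = refl

⟦⟧-nonneg : ∀ b → 0ℤ ≤ᶻ ⟦ b ⟧
⟦⟧-nonneg true  = +≤+ z≤n
⟦⟧-nonneg false = +≤+ z≤n

⟦⟧-split : ∀ b c → ⟦ b ⟧ ≡ ⟦ b ∧ c ⟧ +ᶻ ⟦ b ∧ not c ⟧
⟦⟧-split false c     = refl
⟦⟧-split true  true  = refl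
⟦⟧-split true  false = refl

-- Divides by `q` in the proof of Bessel's inequality; at `q ≡ 0` the claim is the nonnegativity of
-- `c`.
cancel-square : ∀ q c → 0ℤ ≤ᶻ q → 0ℤ ≤ᶻ c → q *ᶻ q ≤ᶻ c *ᶻ q → q ≤ᶻ c
cancel-square (+ zero)  c _ 0≤c _  = 0≤c
cancel-square (+ suc m) c _ _   le = ℤₚ.*-cancelʳ-≤-pos (+ suc m) c (+ suc m) le

∑-square : ∀ {I J : Set} (is : List I) (js : List J) (f : J → I → ℤ) →
  ∑ is (λ i → ∑ js (λ j → f j i) *ᶻ ∑ js (λ j → f j i)) ≡
  ∑ js (λ j → ∑ js (λ k → ∑ is (λ i → f j i *ᶻ f k i)))
∑-square is js f = begin
  ∑ is (λ i → ∑ js (λ j → f j i) *ᶻ ∑ js (λ j → f j i))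
    ≡⟨ ∑-cong is (λ i → sym (∑-product js js (λ j → f j i) (λ j → f j i))) ⟩
  ∑ is (λ i → ∑ js (λ j → ∑ js (λ k → f j i *ᶻ f k i)))
    ≡⟨ ∑-swap is js (λ i j → ∑ js (λ k → f j i *ᶻ f k i)) ⟩
  ∑ js (λ j → ∑ is (λ i → ∑ js (λ k → f j i *ᶻ f k i)))
    ≡⟨ ∑-cong js (λ j → ∑-swap is js (λ i k → f j i *ᶻ f k i)) ⟩
  ∑ js (λ j → ∑ js (λ k → ∑ is (λ i → f j i *ᶻ f k i))) ∎
  where open ≡-Reasoning

-- Fourier coefficients

module _ {n : ℕ} where

  mass : List (Vec Bool n) → (Vec Bool n → Bool) → ℤ
  mass I α = ∑ I (λ i → ⟦ α i ⟧)

  mass-nonneg : ∀ I α → 0ℤ ≤ᶻ mass I α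
  mass-nonneg I α = ∑-nonneg I (λ i → ⟦⟧-nonneg (α i))

  mass-split : ∀ I (α γ : Vec Bool n → Bool) → mass I α ≡ mass I (λ i → α i ∧ γ i) +ᶻ mass I (λ i → α i ∧ not (γ i))
  mass-split I α γ = trans (∑-cong I (λ i → ⟦⟧-split (α i) (γ i))) (∑-+ I _ _)

  fourier : List (Vec Bool n) → (Vec Bool n → Bool) → Vec Bool n → ℤ
  fourier I α t = ∑ I (λ i → ⟦ α i ⟧ *ᶻ χ t i)

  fourier-split : ∀ I (α γ : Vec Bool n → Bool) t →
    fourier I α t ≡ fourier I (λ i → α i ∧ γ i) t +ᶻ fourier I (λ i → α i ∧ not (γ i)) t
  fourier-split I α γ t = trans
    (∑-cong I (λ i → trans (cong (_*ᶻ χ t i) (⟦⟧-split (α i) (γ i))) (ℤₚ.*-distribʳ-+ (χ t i) ⟦ α i ∧ γ i ⟧ ⟦ α i ∧ not (γ i) ⟧)))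
    (∑-+ I (λ i → ⟦ α i ∧ γ i ⟧ *ᶻ χ t i) (λ i → ⟦ α i ∧ not (γ i) ⟧ *ᶻ χ t i))

  -- On the set `α` the character of `u` is the constant `σ`, so translating the frequency by `u`
  -- only scales the coefficient. This is how knowing a parity on one side of a rectangle is
  -- exploited.
  fourier-⊕ : ∀ I α t u σ → (∀ i → α i ≡ true → χ u i ≡ σ) → fourier I α (t ⊕ u) ≡ σ *ᶻ fourier I α t
  fourier-⊕ I α t u σ χu≡σ = trans (∑-cong I eq) (∑-*ˡ I σ (λ i → ⟦ α i ⟧ *ᶻ χ t i))
    where
    rearrange : ∀ a b c → a *ᶻ (b *ᶻ c) ≡ c *ᶻ (a *ᶻ b)
    rearrange = solve-∀
    eq : ∀ i → ⟦ α i ⟧ *ᶻ χ (t ⊕ u) i ≡ σ *ᶻ (⟦ α i ⟧ *ᶻ χ t i)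
    eq i with α i in αi
    ... | false = sym (ℤₚ.*-zeroʳ σ)
    ... | true  = trans (cong (1ℤ *ᶻ_) (trans (χ-⊕ˡ t u i) (cong (χ t i *ᶻ_) (χu≡σ i αi)))) (rearrange 1ℤ (χ t i) σ)

  -- Repeated entries of `I` count with multiplicity, so the output list of a generator can serve as
  -- `I` whether or not its entries are distinct.
  Orthogonal : List (Vec Bool n) → (Vec Bool n → Bool) → Set
  Orthogonal I w = ∀ t u → w t ≡ true → w u ≡ true → t ≢ u → ∑ I (λ i → χ t i *ᶻ χ u i) ≡ 0ℤ

  -- Cauchy-Schwarz is applied to the indicator of `α` and to `p`, which is `length I` times the
  -- orthogonal projection of that indicator onto the characters in `w`. With `Q` for the left-hand
  -- side, their inner product is `Q` and the squared norm of `p` is `length I * Q`; then one factor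
  -- `Q` is cancelled.
  bessel : ∀ I w → Orthogonal I w → ∀ α →
    ∑ (cube n) (λ t → ⟦ w t ⟧ *ᶻ (fourier I α t *ᶻ fourier I α t)) ≤ᶻ + length I *ᶻ mass I α
  bessel I w orth α = cancel-square Q _
      (∑-nonneg (cube n) (λ t → *-nonneg (⟦⟧-nonneg (w t)) (square-nonneg (fourier I α t))))
      (*-nonneg {+ length I} (+≤+ z≤n) (mass-nonneg I α))
      (subst (_≤ᶻ + length I *ᶻ mass I α *ᶻ Q) (cong₂ _*ᶻ_ (sym Q≡⟨α,p⟩) (sym Q≡⟨α,p⟩))
        (ℤₚ.≤-trans (cauchy-schwarz I (λ i → ⟦ α i ⟧) p)
          (ℤₚ.≤-reflexive (trans (cong₂ _*ᶻ_ (∑-cong I (λ i → ⟦⟧-idem (α i))) ⟨p,p⟩≡) (rearrange (mass I α) (+ length I) Q)))))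
    where
    open ≡-Reasoning
    a : Vec Bool n → ℤ
    a t = ⟦ w t ⟧ *ᶻ fourier I α t
    p : Vec Bool n → ℤ
    p i = ∑ (cube n) (λ t → a t *ᶻ χ t i)
    Q : ℤ
    Q = ∑ (cube n) (λ t → ⟦ w t ⟧ *ᶻ (fourier I α t *ᶻ fourier I α t))
    rearrange : ∀ m l q → m *ᶻ (l *ᶻ q) ≡ l *ᶻ m *ᶻ q
    rearrange = solve-∀
    exchange : ∀ x y z → x *ᶻ (y *ᶻ z) ≡ y *ᶻ (x *ᶻ z)
    exchange = solve-∀
    Q≡⟨α,p⟩ : Q ≡ ∑ I (λ i → ⟦ α i ⟧ *ᶻ p i)
    Q≡⟨α,p⟩ = begin
      ∑ (cube n) (λ t → ⟦ w t ⟧ *ᶻ (fourier I α t *ᶻ fourier I α t))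
        ≡⟨ ∑-cong (cube n) (λ t → sym (ℤₚ.*-assoc ⟦ w t ⟧ (fourier I α t) (fourier I α t))) ⟩
      ∑ (cube n) (λ t → a t *ᶻ fourier I α t)
        ≡⟨ ∑-cong (cube n) (λ t → sym (∑-*ˡ I (a t) (λ i → ⟦ α i ⟧ *ᶻ χ t i))) ⟩
      ∑ (cube n) (λ t → ∑ I (λ i → a t *ᶻ (⟦ α i ⟧ *ᶻ χ t i)))
        ≡⟨ ∑-swap (cube n) I (λ t i → a t *ᶻ (⟦ α i ⟧ *ᶻ χ t i)) ⟩
      ∑ I (λ i → ∑ (cube n) (λ t → a t *ᶻ (⟦ α i ⟧ *ᶻ χ t i)))
        ≡⟨ ∑-cong I (λ i → trans (∑-cong (cube n) (λ t → exchange (a t) ⟦ α i ⟧ (χ t i))) (∑-*ˡ (cube n) ⟦ α i ⟧ (λ t → a t *ᶻ χ t i))) ⟩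
      ∑ I (λ i → ⟦ α i ⟧ *ᶻ p i) ∎
    split-χ : ∀ x y z v → (x *ᶻ y) *ᶻ (z *ᶻ v) ≡ (x *ᶻ z) *ᶻ (y *ᶻ v)
    split-χ = solve-∀
    inner : ∀ t u → ∑ I (λ i → (a t *ᶻ χ t i) *ᶻ (a u *ᶻ χ u i)) ≡ (a t *ᶻ a u) *ᶻ ∑ I (λ i → χ t i *ᶻ χ u i)
    inner t u = trans (∑-cong I (λ i → split-χ (a t) (χ t i) (a u) (χ u i))) (∑-*ˡ I (a t *ᶻ a u) (λ i → χ t i *ᶻ χ u i))
    off-diagonal : ∀ t u → t ≢ u → (a t *ᶻ a u) *ᶻ ∑ I (λ i → χ t i *ᶻ χ u i) ≡ 0ℤ
    off-diagonal t u t≢u with w t in wt | w u in wu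
    ... | false | _     = refl
    ... | true  | false = cong (_*ᶻ ∑ I (λ i → χ t i *ᶻ χ u i)) (ℤₚ.*-zeroʳ (1ℤ *ᶻ fourier I α t))
    ... | true  | true  = trans (cong ((1ℤ *ᶻ fourier I α t) *ᶻ (1ℤ *ᶻ fourier I α u) *ᶻ_) (orth t u wt wu t≢u))
                                (ℤₚ.*-zeroʳ ((1ℤ *ᶻ fourier I α t) *ᶻ (1ℤ *ᶻ fourier I α u)))
    square-a : ∀ w f l → w *ᶻ w ≡ w → (w *ᶻ f) *ᶻ (w *ᶻ f) *ᶻ l ≡ l *ᶻ (w *ᶻ (f *ᶻ f))
    square-a w f l idem = trans (regroup w f l) (cong (λ v → l *ᶻ (v *ᶻ (f *ᶻ f))) idem)
      where
      regroup : ∀ w f l → (w *ᶻ f) *ᶻ (w *ᶻ f) *ᶻ l ≡ l *ᶻ ((w *ᶻ w) *ᶻ (f *ᶻ f))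
      regroup = solve-∀
    diagonal : ∀ t → ∑ I (λ i → χ t i *ᶻ χ t i) ≡ + length I
    diagonal t = trans (∑-cong I (λ i → χ-square t i)) (trans (∑-const I 1ℤ) (ℤₚ.*-identityˡ (+ length I)))
    ⟨p,p⟩≡ : ∑ I (λ i → p i *ᶻ p i) ≡ + length I *ᶻ Q
    ⟨p,p⟩≡ = begin
      ∑ I (λ i → p i *ᶻ p i)
        ≡⟨ ∑-square I (cube n) (λ t i → a t *ᶻ χ t i) ⟩
      ∑ (cube n) (λ t → ∑ (cube n) (λ u → ∑ I (λ i → (a t *ᶻ χ t i) *ᶻ (a u *ᶻ χ u i))))
        ≡⟨ ∑-cong (cube n) (λ t → ∑-cong (cube n) (inner t)) ⟩
      ∑ (cube n) (λ t → ∑ (cube n) (λ u → (a t *ᶻ a u) *ᶻ ∑ I (λ i → χ t i *ᶻ χ u i)))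
        ≡⟨ ∑-cong (cube n) (λ t → ∑-cube-single t _ (off-diagonal t)) ⟩
      ∑ (cube n) (λ t → (a t *ᶻ a t) *ᶻ ∑ I (λ i → χ t i *ᶻ χ t i))
        ≡⟨ ∑-cong (cube n) (λ t → trans (cong (a t *ᶻ a t *ᶻ_) (diagonal t))
             (square-a ⟦ w t ⟧ (fourier I α t) (+ length I) (⟦⟧-idem (w t)))) ⟩
      ∑ (cube n) (λ t → + length I *ᶻ (⟦ w t ⟧ *ᶻ (fourier I α t *ᶻ fourier I α t)))
        ≡⟨ ∑-*ˡ (cube n) (+ length I) (λ t → ⟦ w t ⟧ *ᶻ (fourier I α t *ᶻ fourier I α t)) ⟩
      + length I *ᶻ Q ∎

  cube-orthogonal : ∀ w → Orthogonal (cube n) w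
  cube-orthogonal w t u _ _ t≢u =
    trans (∑-cong (cube n) (λ x → sym (χ-⊕ˡ t u x))) (∑-χ (t ⊕ u) (t≢u ∘ ⊕≡𝟘⇒≡ t u))

-- The adversary bound

size-pos : ∀ {n} (F : Formula n) → 1 ≤ size F
size-pos (leaf i)  = s≤s z≤n
size-pos (and F G) = ℕₚ.≤-trans (size-pos F) (ℕₚ.m≤m+n _ _)
size-pos (or F G)  = ℕₚ.≤-trans (size-pos F) (ℕₚ.m≤m+n _ _)
size-pos (neg F)   = size-pos F

-- Sedrakyan's form of the Cauchy–Schwarz inequality, cleared of denominators.
square-sum-≤ : ∀ {s₁ s₂} m₁ m₂ p₁ p₂ → 1 ≤ s₁ → 1 ≤ s₂ →
  + 4 *ᶻ (m₁ *ᶻ m₁) ≤ᶻ + s₁ *ᶻ p₁ → + 4 *ᶻ (m₂ *ᶻ m₂) ≤ᶻ + s₂ *ᶻ p₂ →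
  + 4 *ᶻ ((m₁ +ᶻ m₂) *ᶻ (m₁ +ᶻ m₂)) ≤ᶻ + (s₁ + s₂) *ᶻ (p₁ +ᶻ p₂)
square-sum-≤ {suc s₁} {suc s₂} m₁ m₂ p₁ p₂ _ _ le₁ le₂ =
  ℤₚ.*-cancelˡ-≤-pos _ _ (S₁ *ᶻ S₂)
    (begin
      (S₁ *ᶻ S₂) *ᶻ (+ 4 *ᶻ ((m₁ +ᶻ m₂) *ᶻ (m₁ +ᶻ m₂)))
        ≤⟨ ℤₚ.0≤i-j⇒j≤i (subst (0ℤ ≤ᶻ_) (sym (identity S₁ S₂ m₁ m₂))
             (*-nonneg {+ 4} (+≤+ z≤n) (square-nonneg (S₂ *ᶻ m₁ -ᶻ S₁ *ᶻ m₂)))) ⟩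
      (S₁ +ᶻ S₂) *ᶻ (S₂ *ᶻ (+ 4 *ᶻ (m₁ *ᶻ m₁)) +ᶻ S₁ *ᶻ (+ 4 *ᶻ (m₂ *ᶻ m₂)))
        ≤⟨ ℤₚ.*-monoˡ-≤-nonNeg (S₁ +ᶻ S₂) (ℤₚ.+-mono-≤ (ℤₚ.*-monoˡ-≤-nonNeg S₂ le₁) (ℤₚ.*-monoˡ-≤-nonNeg S₁ le₂)) ⟩
      (S₁ +ᶻ S₂) *ᶻ (S₂ *ᶻ (S₁ *ᶻ p₁) +ᶻ S₁ *ᶻ (S₂ *ᶻ p₂))
        ≡⟨ factor S₁ S₂ p₁ p₂ ⟩
      (S₁ *ᶻ S₂) *ᶻ ((S₁ +ᶻ S₂) *ᶻ (p₁ +ᶻ p₂)) ∎)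
  where
  open ℤₚ.≤-Reasoning
  S₁ S₂ : ℤ
  S₁ = + suc s₁
  S₂ = + suc s₂
  identity : ∀ a b m n →
    (a +ᶻ b) *ᶻ (b *ᶻ (+ 4 *ᶻ (m *ᶻ m)) +ᶻ a *ᶻ (+ 4 *ᶻ (n *ᶻ n))) -ᶻ (a *ᶻ b) *ᶻ (+ 4 *ᶻ ((m +ᶻ n) *ᶻ (m +ᶻ n)))
    ≡ + 4 *ᶻ ((b *ᶻ m -ᶻ a *ᶻ n) *ᶻ (b *ᶻ m -ᶻ a *ᶻ n))
  identity = solve-∀
  factor : ∀ a b p q → (a +ᶻ b) *ᶻ (b *ᶻ (a *ᶻ p) +ᶻ a *ᶻ (b *ᶻ q)) ≡ (a *ᶻ b) *ᶻ ((a +ᶻ b) *ᶻ (p +ᶻ q))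
  factor = solve-∀

module Adversary {n s : ℕ} (S : Fin s → Vec Bool n) (negated : Fin s → Bool) where

  input-bits : Vec Bool n → Fin s → Bool
  input-bits x i = negated i xor dot (S i) x

  eval : Formula s → Vec Bool n → Bool
  eval F x = evalFormula F (input-bits x)

  -- The extra summand `𝟘` turns sums of exactly `i` vectors into sums of at most `i`. Repetitions
  -- are kept, so the length is a power of `suc s`, as the choice of the generator requires.
  ball : ℕ → List (Vec Bool n)
  ball zero    = 𝟘 ∷ []
  ball (suc i) = cartesianProductWith _⊕_ (ball i) (𝟘 ∷ List.tabulate S)

  _∈?ball_ : ∀ t i → Dec (t ∈ ball i)
  t ∈?ball i = any? (≡-dec Boolₚ._≟_ t) (ball i)

  inBall : ℕ → Vec Bool n → Bool
  inBall i t = does (t ∈?ball i)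

  inBall⇒∈ : ∀ i t → inBall i t ≡ true → t ∈ ball i
  inBall⇒∈ i t eq with t ∈?ball i
  ... | yes t∈ = t∈

  ∈⇒inBall : ∀ i t → t ∈ ball i → inBall i t ≡ true
  ∈⇒inBall i t = dec-true (t ∈?ball i)

  ball-suc : ∀ i {t} → t ∈ ball i → t ∈ ball (suc i)
  ball-suc i t∈ = subst (_∈ ball (suc i)) (⊕-identityʳ _) (∈-cartesianProductWith⁺ _⊕_ t∈ (here refl))

  ball-⊕ : ∀ i {t} j → t ∈ ball i → (t ⊕ S j) ∈ ball (suc i)
  ball-⊕ i j t∈ = ∈-cartesianProductWith⁺ _⊕_ t∈ (there (∈-tabulate⁺ j))

  𝟘∈ball : ∀ i → 𝟘 ∈ ball i
  𝟘∈ball zero    = here refl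
  𝟘∈ball (suc i) = ball-suc i (𝟘∈ball i)

  -- d minus the distance of t from 𝟘 in the Cayley graph of the S j, or 0 if that is negative.
  weight : ℕ → Vec Bool n → ℕ
  weight zero    t = 0
  weight (suc d) t = weight d t + 𝟙 (inBall d t)

  weight-𝟘 : ∀ d → weight d 𝟘 ≡ d
  weight-𝟘 zero    = refl
  weight-𝟘 (suc d) = trans (cong₂ _+_ (weight-𝟘 d) (cong 𝟙 (∈⇒inBall d 𝟘 (𝟘∈ball d)))) (ℕₚ.+-comm d 1)

  inBall-suc : ∀ d t → inBall d t ≡ true → inBall (suc d) t ≡ true
  inBall-suc d t eq = ∈⇒inBall (suc d) t (ball-suc d (inBall⇒∈ d t eq))

  weight-outside : ∀ d t → inBall d t ≡ false → weight d t ≡ 0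
  weight-outside zero    t out = refl
  weight-outside (suc d) t out with inBall d t in eq
  ... | true  with () ← trans (sym (inBall-suc d t eq)) out
  ... | false = trans (ℕₚ.+-identityʳ _) (weight-outside d t eq)

  -- `weight d t` counts the `i < d` with `t` in `ball i`. If `t ⊕ S j` lies in `ball i`, then `t`
  -- lies in `ball (suc i)`; so the count for `t ⊕ S j` is compared with the count for `t` shifted
  -- by one index, whose last term is the indicator of `ball d`.
  weight-⊕-≤ : ∀ d t j → weight d (t ⊕ S j) ≤ weight d t + 𝟙 (inBall d t)
  weight-⊕-≤ zero    t j = z≤n
  weight-⊕-≤ (suc d) t j = ℕₚ.+-mono-≤ (weight-⊕-≤ d t j) (𝟙-mono λ eq →
    subst (λ u → inBall (suc d) u ≡ true) (⊕-cancelʳ t (S j))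
      (∈⇒inBall (suc d) _ (ball-⊕ d j (inBall⇒∈ d _ eq))))

  difference : ℕ → Fin s → Vec Bool n → ℤ
  difference d j t = + weight d t -ᶻ + weight d (t ⊕ S j)

  -- A step of the Cayley graph changes the weight by at most 1. Outside `ball d` both weights are
  -- zero, because a neighbour of positive weight would put `t` inside. Hence orthogonality on
  -- `ball d` is what the leaves of the protocol call for.
  difference-square : ∀ d j t → difference d j t *ᶻ difference d j t ≤ᶻ ⟦ inBall d t ⟧
  difference-square d j t with inBall d t in eq
  ... | false = ℤₚ.≤-reflexive (cong₂ (λ a b → (+ a -ᶻ + b) *ᶻ (+ a -ᶻ + b)) wt
                  (ℕₚ.n≤0⇒n≡0 (subst (weight d (t ⊕ S j) ≤_) (cong₂ _+_ wt (cong 𝟙 eq)) (weight-⊕-≤ d t j))))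
    where
    wt : weight d t ≡ 0
    wt = weight-outside d t eq
  ... | true = close (weight d t) (weight d (t ⊕ S j))
                 (subst (λ u → weight d u ≤ weight d (t ⊕ S j) + 1) (⊕-cancelʳ t (S j))
                   (ℕₚ.≤-trans (weight-⊕-≤ d (t ⊕ S j) j) (ℕₚ.+-monoʳ-≤ _ (𝟙≤1 (inBall d (t ⊕ S j))))))
                 (ℕₚ.≤-trans (weight-⊕-≤ d t j) (ℕₚ.+-monoʳ-≤ _ (𝟙≤1 (inBall d t))))
    where
    𝟙≤1 : ∀ b → 𝟙 b ≤ 1
    𝟙≤1 true  = s≤s z≤n
    𝟙≤1 false = z≤n
    close : ∀ a b → a ≤ b + 1 → b ≤ a + 1 → (+ a -ᶻ + b) *ᶻ (+ a -ᶻ + b) ≤ᶻ 1ℤ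
    close zero    zero          _ _ = +≤+ z≤n
    close zero    (suc zero)    _ _ = +≤+ (s≤s z≤n)
    close zero    (suc (suc b)) _ (s≤s ())
    close (suc zero) zero       _ _ = +≤+ (s≤s z≤n)
    close (suc (suc a)) zero    (s≤s ()) _
    close (suc a) (suc b) (s≤s p) (s≤s q) =
      subst (λ c → c *ᶻ c ≤ᶻ 1ℤ) (sym (pred (+ a) (+ b))) (close a b p q)
      where
      pred : ∀ x y → (1ℤ +ᶻ x) -ᶻ (1ℤ +ᶻ y) ≡ x -ᶻ y
      pred = solve-∀

  module _ (d : ℕ) (R : List (Vec Bool n)) (orthogonal : Orthogonal R (inBall d)) where

    X : List (Vec Bool n)
    X = cube n

    -- The sum of K over the rectangle α × β.
    correlation : (α β : Vec Bool n → Bool) → ℤ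
    correlation α β = ∑ X (λ t → + weight d t *ᶻ (fourier R α t *ᶻ fourier X β t))

    -- Four times the square of the correlation is at most the budget on a
    -- rectangle of the protocol, and the budget is additive in α and in β.
    budget : (α β : Vec Bool n → Bool) → ℤ
    budget α β = (+ length R *ᶻ mass R α) *ᶻ (+ length X *ᶻ mass X β)

    Bounded : ℕ → (α β : Vec Bool n → Bool) → Set
    Bounded s α β = + 4 *ᶻ (correlation α β *ᶻ correlation α β) ≤ᶻ + s *ᶻ budget α β

    -- Correlation and budget are both additive in `α`, so `square-sum-≤` merges the two parts. In
    -- the Karchmer-Wigderson protocol this is a message of the player holding a point of `α`.
    bounded-splitˡ : ∀ {s₁ s₂} α β (γ : Vec Bool n → Bool) → 1 ≤ s₁ → 1 ≤ s₂ →
      Bounded s₁ (λ x → α x ∧ γ x) β → Bounded s₂ (λ x → α x ∧ not (γ x)) β → Bounded (s₁ + s₂) α β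
    bounded-splitˡ {s₁} {s₂} α β γ 1≤s₁ 1≤s₂ b₁ b₂ =
      subst₂ (λ m p → + 4 *ᶻ (m *ᶻ m) ≤ᶻ + (s₁ + s₂) *ᶻ p) (sym corr) (sym budg)
        (square-sum-≤ (correlation α₁ β) (correlation α₂ β) (budget α₁ β) (budget α₂ β) 1≤s₁ 1≤s₂ b₁ b₂)
      where
      α₁ α₂ : Vec Bool n → Bool
      α₁ x = α x ∧ γ x
      α₂ x = α x ∧ not (γ x)
      distrib : ∀ w a b c → w *ᶻ ((a +ᶻ b) *ᶻ c) ≡ w *ᶻ (a *ᶻ c) +ᶻ w *ᶻ (b *ᶻ c)
      distrib = solve-∀
      corr : correlation α β ≡ correlation α₁ β +ᶻ correlation α₂ β
      corr = trans
        (∑-cong X (λ t → trans (cong (λ f → + weight d t *ᶻ (f *ᶻ fourier X β t)) (fourier-split R α γ t))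
                               (distrib (+ weight d t) (fourier R α₁ t) (fourier R α₂ t) (fourier X β t))))
        (∑-+ X (λ t → + weight d t *ᶻ (fourier R α₁ t *ᶻ fourier X β t)) (λ t → + weight d t *ᶻ (fourier R α₂ t *ᶻ fourier X β t)))
      distrib′ : ∀ l a b c → (l *ᶻ (a +ᶻ b)) *ᶻ c ≡ (l *ᶻ a) *ᶻ c +ᶻ (l *ᶻ b) *ᶻ c
      distrib′ = solve-∀
      budg : budget α β ≡ budget α₁ β +ᶻ budget α₂ β
      budg = trans (cong (λ m → (+ length R *ᶻ m) *ᶻ (+ length X *ᶻ mass X β)) (mass-split R α γ))
                   (distrib′ (+ length R) (mass R α₁) (mass R α₂) (+ length X *ᶻ mass X β))

    bounded-splitʳ : ∀ {s₁ s₂} α β (γ : Vec Bool n → Bool) → 1 ≤ s₁ → 1 ≤ s₂ →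
      Bounded s₁ α (λ x → β x ∧ γ x) → Bounded s₂ α (λ x → β x ∧ not (γ x)) → Bounded (s₁ + s₂) α β
    bounded-splitʳ {s₁} {s₂} α β γ 1≤s₁ 1≤s₂ b₁ b₂ =
      subst₂ (λ m p → + 4 *ᶻ (m *ᶻ m) ≤ᶻ + (s₁ + s₂) *ᶻ p) (sym corr) (sym budg)
        (square-sum-≤ (correlation α β₁) (correlation α β₂) (budget α β₁) (budget α β₂) 1≤s₁ 1≤s₂ b₁ b₂)
      where
      β₁ β₂ : Vec Bool n → Bool
      β₁ x = β x ∧ γ x
      β₂ x = β x ∧ not (γ x)
      distrib : ∀ w a b c → w *ᶻ (a *ᶻ (b +ᶻ c)) ≡ w *ᶻ (a *ᶻ b) +ᶻ w *ᶻ (a *ᶻ c)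
      distrib = solve-∀
      corr : correlation α β ≡ correlation α β₁ +ᶻ correlation α β₂
      corr = trans
        (∑-cong X (λ t → trans (cong (λ f → + weight d t *ᶻ (fourier R α t *ᶻ f)) (fourier-split X β γ t))
                               (distrib (+ weight d t) (fourier R α t) (fourier X β₁ t) (fourier X β₂ t))))
        (∑-+ X (λ t → + weight d t *ᶻ (fourier R α t *ᶻ fourier X β₁ t)) (λ t → + weight d t *ᶻ (fourier R α t *ᶻ fourier X β₂ t)))
      distrib′ : ∀ c l a b → c *ᶻ (l *ᶻ (a +ᶻ b)) ≡ c *ᶻ (l *ᶻ a) +ᶻ c *ᶻ (l *ᶻ b)
      distrib′ = solve-∀
      budg : budget α β ≡ budget α β₁ +ᶻ budget α β₂
      budg = trans (cong (λ m → (+ length R *ᶻ mass R α) *ᶻ (+ length X *ᶻ m)) (mass-split X β γ))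
                   (distrib′ (+ length R *ᶻ mass R α) (+ length X) (mass X β₁) (mass X β₂))

    -- On a rectangle where the parity S j separates the two sides, translating
    -- by S j negates every product of Fourier coefficients.
    bounded-leaf : ∀ j v α β → (∀ x → α x ≡ true → input-bits x j ≡ v) →
      (∀ x → β x ≡ true → input-bits x j ≡ not v) → Bounded 1 α β
    bounded-leaf j v α β α⇒ β⇒ = begin
      + 4 *ᶻ (M *ᶻ M)
        ≡⟨ double-square M ⟩
      (M +ᶻ M) *ᶻ (M +ᶻ M)
        ≡⟨ cong (λ m → m *ᶻ m) 2M≡ ⟩
      ∑ X (λ t → cA t *ᶻ B t) *ᶻ ∑ X (λ t → cA t *ᶻ B t)
        ≤⟨ cauchy-schwarz X cA B ⟩
      ∑ X (λ t → cA t *ᶻ cA t) *ᶻ ∑ X (λ t → B t *ᶻ B t)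
        ≤⟨ *-mono-nonneg (∑-nonneg X (λ t → square-nonneg (B t))) (*-nonneg {+ length R} (+≤+ z≤n) (mass-nonneg R α)) cA≤ B≤ ⟩
      budget α β
        ≡⟨ sym (ℤₚ.*-identityˡ (budget α β)) ⟩
      1ℤ *ᶻ budget α β ∎
      where
      open ℤₚ.≤-Reasoning
      M : ℤ
      M = correlation α β
      A B cA : Vec Bool n → ℤ
      A = fourier R α
      B = fourier X β
      cA t = difference d j t *ᶻ A t
      σ : Bool
      σ = negated j xor v
      solve-xor : ∀ a b c → a xor b ≡ c → b ≡ a xor c
      solve-xor false b c eq = eq
      solve-xor true  b c eq = trans (sym (not-involutive b)) (cong not eq)
      not-xor : ∀ a b → a xor not b ≡ not (a xor b)
      not-xor false b = refl
      not-xor true  b = refl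
      opposite : ∀ b → sgn b *ᶻ sgn (not b) ≡ -1ℤ
      opposite true  = refl
      opposite false = refl
      A-shift : ∀ t → A (t ⊕ S j) ≡ sgn σ *ᶻ A t
      A-shift t = fourier-⊕ R α t (S j) (sgn σ) (λ x αx → cong sgn (solve-xor (negated j) _ v (α⇒ x αx)))
      B-shift : ∀ t → B (t ⊕ S j) ≡ sgn (not σ) *ᶻ B t
      B-shift t = fourier-⊕ X β t (S j) (sgn (not σ)) (λ x βx → cong sgn
        (trans (solve-xor (negated j) _ (not v) (β⇒ x βx)) (not-xor (negated j) v)))
      regroup : ∀ p q a b → (p *ᶻ a) *ᶻ (q *ᶻ b) ≡ (p *ᶻ q) *ᶻ (a *ᶻ b)
      regroup = solve-∀
      AB-shift : ∀ t → A (t ⊕ S j) *ᶻ B (t ⊕ S j) ≡ -1ℤ *ᶻ (A t *ᶻ B t)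
      AB-shift t = trans (cong₂ _*ᶻ_ (A-shift t) (B-shift t))
        (trans (regroup (sgn σ) (sgn (not σ)) (A t) (B t)) (cong (_*ᶻ (A t *ᶻ B t)) (opposite σ)))
      collect : ∀ w v a b → w *ᶻ (a *ᶻ b) +ᶻ v *ᶻ (-1ℤ *ᶻ (a *ᶻ b)) ≡ ((w -ᶻ v) *ᶻ a) *ᶻ b
      collect = solve-∀
      -- `M` is added to its own reindexing by `t ↦ t ⊕ S j`; the products of coefficients differ in
      -- sign only, which leaves the differences of the weights.
      2M≡ : M +ᶻ M ≡ ∑ X (λ t → cA t *ᶻ B t)
      2M≡ = trans (cong (M +ᶻ_) (sym (∑-cube-shift (S j) (λ t → + weight d t *ᶻ (A t *ᶻ B t)))))
        (trans (sym (∑-+ X (λ t → + weight d t *ᶻ (A t *ᶻ B t)) (λ t → + weight d (t ⊕ S j) *ᶻ (A (t ⊕ S j) *ᶻ B (t ⊕ S j)))))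
          (∑-cong X (λ t → trans (cong (λ p → + weight d t *ᶻ (A t *ᶻ B t) +ᶻ + weight d (t ⊕ S j) *ᶻ p) (AB-shift t))
                                 (collect (+ weight d t) (+ weight d (t ⊕ S j)) (A t) (B t)))))
      double-square : ∀ m → + 4 *ᶻ (m *ᶻ m) ≡ (m +ᶻ m) *ᶻ (m +ᶻ m)
      double-square = solve-∀
      square-product : ∀ c a → (c *ᶻ a) *ᶻ (c *ᶻ a) ≡ (a *ᶻ a) *ᶻ (c *ᶻ c)
      square-product = solve-∀
      cA≤ : ∑ X (λ t → cA t *ᶻ cA t) ≤ᶻ + length R *ᶻ mass R α
      cA≤ = ℤₚ.≤-trans
        (∑-mono X (λ t → subst (_≤ᶻ ⟦ inBall d t ⟧ *ᶻ (A t *ᶻ A t)) (sym (square-product (difference d j t) (A t)))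
          (subst (A t *ᶻ A t *ᶻ (difference d j t *ᶻ difference d j t) ≤ᶻ_) (ℤₚ.*-comm (A t *ᶻ A t) ⟦ inBall d t ⟧)
            (*-monoˡ-≤ᶻ _ _ (square-nonneg (A t)) (difference-square d j t)))))
        (bessel R (inBall d) orthogonal α)
      -- Over the full cube all characters are pairwise orthogonal, so here Bessel's inequality
      -- covers every frequency at once.
      B≤ : ∑ X (λ t → B t *ᶻ B t) ≤ᶻ + length X *ᶻ mass X β
      B≤ = subst (_≤ᶻ + length X *ᶻ mass X β) (∑-cong X (λ t → ℤₚ.*-identityˡ (B t *ᶻ B t)))
        (bessel X (λ _ → true) (cube-orthogonal (λ _ → true)) β)
      *-mono-nonneg : ∀ {a b p q} → 0ℤ ≤ᶻ b → 0ℤ ≤ᶻ p → a ≤ᶻ p → b ≤ᶻ q → a *ᶻ b ≤ᶻ p *ᶻ q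
      *-mono-nonneg {a} {b} {p} {q} 0≤b 0≤p a≤p b≤q = ℤₚ.≤-trans
        (subst (λ z → z ≤ᶻ p *ᶻ b) (ℤₚ.*-comm b a) (subst (b *ᶻ a ≤ᶻ_) (ℤₚ.*-comm b p) (*-monoˡ-≤ᶻ a p 0≤b a≤p)))
        (*-monoˡ-≤ᶻ b q 0≤p b≤q)

    -- Induction along the Karchmer-Wigderson protocol: at a binary gate one side is split by the
    -- value of the left subformula, and each part is separated from the other side by one of the
    -- two subformulas. Since `α` is weighed by `R` and `β` by the cube, a negation flips `v`
    -- instead of exchanging the sides.
    bounded-formula : ∀ F v α β → (∀ x → α x ≡ true → eval F x ≡ v) →
      (∀ x → β x ≡ true → eval F x ≡ not v) → Bounded (size F) α β
    bounded-formula (leaf j) v α β α⇒ β⇒ = bounded-leaf j v α β α⇒ β⇒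
    bounded-formula (neg F) v α β α⇒ β⇒ =
      bounded-formula F (not v) α β
        (λ x αx → flip (α⇒ x αx)) (λ x βx → flip (β⇒ x βx))
      where
      flip : ∀ {a b} → not a ≡ b → a ≡ not b
      flip eq = not-injective (trans eq (sym (not-involutive _)))
    bounded-formula (and F G) true α β α⇒ β⇒ =
      bounded-splitʳ α β (λ x → not (eval F x)) (size-pos F) (size-pos G)
        (bounded-formula F true α _ (λ x αx → proj₁ (∧-split (α⇒ x αx)))
          (λ x p → not-injective (proj₂ (∧-split p))))
        (bounded-formula G true α _ (λ x αx → proj₂ (∧-split {eval F x} (α⇒ x αx)))
          (λ x p → second (proj₂ (∧-split {β x} p)) (β⇒ x (proj₁ (∧-split p)))))
      where
      second : ∀ {a b} → not (not a) ≡ true → a ∧ b ≡ false → b ≡ false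
      second {true} _ eq = eq
    bounded-formula (and F G) false α β α⇒ β⇒ =
      bounded-splitˡ α β (λ x → not (eval F x)) (size-pos F) (size-pos G)
        (bounded-formula F false _ β (λ x p → not-injective (proj₂ (∧-split p)))
          (λ x βx → proj₁ (∧-split (β⇒ x βx))))
        (bounded-formula G false _ β (λ x p → second (proj₂ (∧-split {α x} p)) (α⇒ x (proj₁ (∧-split p))))
          (λ x βx → proj₂ (∧-split {eval F x} (β⇒ x βx))))
      where
      second : ∀ {a b} → not (not a) ≡ true → a ∧ b ≡ false → b ≡ false
      second {true} _ eq = eq
    bounded-formula (or F G) true α β α⇒ β⇒ =
      bounded-splitˡ α β (eval F) (size-pos F) (size-pos G)
        (bounded-formula F true _ β (λ x p → proj₂ (∧-split p)) (λ x βx → proj₁ (∨-split (β⇒ x βx))))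
        (bounded-formula G true _ β (λ x p → second (proj₂ (∧-split {α x} p)) (α⇒ x (proj₁ (∧-split p))))
          (λ x βx → proj₂ (∨-split {eval F x} (β⇒ x βx))))
      where
      second : ∀ {a b} → not a ≡ true → a ∨ b ≡ true → b ≡ true
      second {false} _ eq = eq
    bounded-formula (or F G) false α β α⇒ β⇒ =
      bounded-splitʳ α β (eval F) (size-pos F) (size-pos G)
        (bounded-formula F false α _ (λ x αx → proj₁ (∨-split (α⇒ x αx))) (λ x p → proj₂ (∧-split p)))
        (bounded-formula G false α _ (λ x αx → proj₂ (∨-split {eval F x} (α⇒ x αx)))
          (λ x p → second (proj₂ (∧-split {β x} p)) (β⇒ x (proj₁ (∧-split p)))))
      where
      second : ∀ {a b} → not a ≡ true → a ∨ b ≡ true → b ≡ true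
      second {false} _ eq = eq

length-cube : ∀ n → length (cube n) ≡ 2 ^ n
length-cube zero    = refl
length-cube (suc n) = trans (length-++ (List.map (false ∷_) (cube n)))
  (cong₂ _+_ (trans (length-map _ (cube n)) (length-cube n))
             (trans (length-map _ (cube n)) (trans (length-cube n) (sym (ℕₚ.+-identityʳ (2 ^ n))))))

∑-indicator : ∀ {I : Set} {α : I → Bool} (f : I → ℤ) {is} → All (λ i → α i ≡ true) is →
  ∑ is (λ i → ⟦ α i ⟧ *ᶻ f i) ≡ ∑ is f
∑-indicator f []         = refl
∑-indicator f {i ∷ _} (αi ∷ αs) =
  cong₂ _+ᶻ_ (trans (cong (λ b → ⟦ b ⟧ *ᶻ f i) αi) (ℤₚ.*-identityˡ (f i))) (∑-indicator f αs)

module _ {n s : ℕ} (S : Fin s → Vec Bool n) (negated : Fin s → Bool) where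

  open Adversary S negated

  module _ (d : ℕ) (R : List (Vec Bool n)) (orthogonal : Orthogonal R (inBall d))
    (F : Formula s) (accepts : All (λ a → eval F a ≡ true) R) where

    rejects : Vec Bool n → Bool
    rejects x = not (eval F x)

    -- As `F` accepts all of `R`, its coefficient at `t` is the sum of `χ t` over `R`, which is zero
    -- for `t ≢ 𝟘` in the ball by orthogonality to `χ 𝟘`. Outside the ball the weight is zero, so
    -- only the frequency `𝟘`, of weight `d`, remains.
    correlation-accept-reject : correlation d R orthogonal (eval F) rejects ≡ + d *ᶻ (+ length R *ᶻ mass (cube n) rejects)
    correlation-accept-reject = trans (∑-cube-single 𝟘 _ off) (cong₂ _*ᶻ_ (cong +_ (weight-𝟘 d)) (cong₂ _*ᶻ_ fourier-R fourier-X))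
      where
      χ-𝟘 : ∀ x → χ 𝟘 x ≡ 1ℤ
      χ-𝟘 x = cong sgn (dot-𝟘ˡ x)
      fourier-R : fourier R (eval F) 𝟘 ≡ + length R
      fourier-R = trans (∑-indicator (χ 𝟘) accepts)
        (trans (∑-cong R χ-𝟘) (trans (∑-const R 1ℤ) (ℤₚ.*-identityˡ (+ length R))))
      fourier-X : fourier (cube n) rejects 𝟘 ≡ mass (cube n) rejects
      fourier-X = ∑-cong (cube n) (λ x → trans (cong (⟦ rejects x ⟧ *ᶻ_) (χ-𝟘 x)) (ℤₚ.*-identityʳ ⟦ rejects x ⟧))
      off : ∀ t → 𝟘 ≢ t → + weight d t *ᶻ (fourier R (eval F) t *ᶻ fourier (cube n) rejects t) ≡ 0ℤ
      off t 𝟘≢t with inBall d t in eq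
      ... | false = cong (λ w → + w *ᶻ (fourier R (eval F) t *ᶻ fourier (cube n) rejects t)) (weight-outside d t eq)
      ... | true  = trans (cong (λ f → + weight d t *ᶻ (f *ᶻ fourier (cube n) rejects t)) vanish) (ℤₚ.*-zeroʳ (+ weight d t))
        where
        vanish : fourier R (eval F) t ≡ 0ℤ
        vanish = trans (∑-indicator (χ t) accepts)
          (trans (∑-cong R (λ x → sym (trans (cong (χ t x *ᶻ_) (χ-𝟘 x)) (ℤₚ.*-identityʳ (χ t x)))))
            (orthogonal t 𝟘 eq (∈⇒inBall d 𝟘 (𝟘∈ball d)) (λ t≡𝟘 → 𝟘≢t (sym t≡𝟘))))

    -- Let `r` be the length of `R`, `x` that of the cube and `m` the number of rejected tables. On
    -- F⁻¹(1) × F⁻¹(0), `bounded-formula` says that 4 (d r m)² is at most `size F` times r² x m.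
    -- Cancelling r² m and using x ≤ 2 m leaves the claim; m is positive since the cube is nonempty.
    adversary-bound : 1 ≤ length R → + length (cube n) ≤ᶻ + 2 *ᶻ mass (cube n) rejects → 2 * (d * d) ≤ size F
    adversary-bound 1≤r majority = ℤₚ.drop‿+≤+ (subst (_≤ᶻ + size F) (sym (trans (ℤₚ.pos-* 2 (d * d)) (cong (+ 2 *ᶻ_) (ℤₚ.pos-* d d))))
        (cancel (mass (cube n) rejects) (length R) (length (cube n)) 1≤r (subst (1 ≤_) (sym (length-cube n)) (ℕₚ.m^n>0 2 n)) majority total))
      where
      total : + 4 *ᶻ ((+ d *ᶻ (+ length R *ᶻ mass (cube n) rejects)) *ᶻ (+ d *ᶻ (+ length R *ᶻ mass (cube n) rejects))) ≤ᶻ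
              + size F *ᶻ ((+ length R *ᶻ + length R) *ᶻ (+ length (cube n) *ᶻ mass (cube n) rejects))
      total = subst₂ (λ m w → + 4 *ᶻ (m *ᶻ m) ≤ᶻ + size F *ᶻ ((+ length R *ᶻ w) *ᶻ (+ length (cube n) *ᶻ mass (cube n) rejects)))
        correlation-accept-reject
        (trans (∑-cong R (λ i → sym (ℤₚ.*-identityʳ ⟦ eval F i ⟧)))
          (trans (∑-indicator (λ _ → 1ℤ) accepts) (trans (∑-const R 1ℤ) (ℤₚ.*-identityˡ (+ length R)))))
        (bounded-formula d R orthogonal F true (eval F) rejects (λ _ eq → eq) (λ _ eq → not-injective eq))
      regroupˡ : ∀ d r m → + 4 *ᶻ ((d *ᶻ (r *ᶻ m)) *ᶻ (d *ᶻ (r *ᶻ m))) ≡ (+ 2 *ᶻ (d *ᶻ d)) *ᶻ (+ 2 *ᶻ m) *ᶻ (r *ᶻ r *ᶻ m)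
      regroupˡ = solve-∀
      regroupʳ : ∀ s r x m → s *ᶻ ((r *ᶻ r) *ᶻ (x *ᶻ m)) ≡ (s *ᶻ x) *ᶻ (r *ᶻ r *ᶻ m)
      regroupʳ = solve-∀
      cancel : ∀ m r x → 1 ≤ r → 1 ≤ x → + x ≤ᶻ + 2 *ᶻ m →
        + 4 *ᶻ ((+ d *ᶻ (+ r *ᶻ m)) *ᶻ (+ d *ᶻ (+ r *ᶻ m))) ≤ᶻ + size F *ᶻ ((+ r *ᶻ + r) *ᶻ (+ x *ᶻ m)) →
        + 2 *ᶻ (+ d *ᶻ + d) ≤ᶻ + size F
      cancel (+ zero)  r (suc x) _ _ (+≤+ ()) _
      cancel (+ suc m) (suc r) x _ _ maj le =
        ℤₚ.*-cancelʳ-≤-pos _ _ (+ 2 *ᶻ + suc m)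
          (ℤₚ.≤-trans (ℤₚ.*-cancelʳ-≤-pos _ _ (+ suc r *ᶻ + suc r *ᶻ + suc m)
              (subst₂ _≤ᶻ_ (regroupˡ (+ d) (+ suc r) (+ suc m)) (regroupʳ (+ size F) (+ suc r) (+ x) (+ suc m)) le))
            (*-monoˡ-≤ᶻ {+ size F} (+ x) _ (+≤+ z≤n) maj))

-- A generator that fools prescribed characters

count : ∀ {I : Set} → (I → Bool) → List I → ℕ
count p []       = 0
count p (i ∷ is) = 𝟙 (p i) + count p is

count-mono : ∀ {I : Set} {p q : I → Bool} is → (∀ i → p i ≡ true → q i ≡ true) → count p is ≤ count q is
count-mono []       imp = z≤n
count-mono {p = p} {q} (i ∷ is) imp = ℕₚ.+-mono-≤ pointwise (count-mono is imp)
  where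
  pointwise : 𝟙 (p i) ≤ 𝟙 (q i)
  pointwise with p i in pi
  ... | false = z≤n
  ... | true rewrite imp i pi = ℕₚ.≤-refl

count-∪ : ∀ {I : Set} {p q r : I → Bool} is → (∀ i → p i ≡ true → q i ≡ true ⊎ r i ≡ true) →
  count p is ≤ count q is + count r is
count-∪ []       imp = z≤n
count-∪ {p = p} {q} {r} (i ∷ is) imp = ℕₚ.≤-trans (ℕₚ.+-mono-≤ pointwise (count-∪ is imp))
    (ℕₚ.≤-reflexive (medial (𝟙 (q i)) (𝟙 (r i)) (count q is) (count r is)))
  where
  medial : ∀ a b c d → (a + b) + (c + d) ≡ (a + c) + (b + d)
  medial = solve-∀ℕ
  pointwise : 𝟙 (p i) ≤ 𝟙 (q i) + 𝟙 (r i)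
  pointwise with p i in pi
  ... | false = z≤n
  ... | true with imp i pi
  ...   | inj₁ qi rewrite qi = s≤s z≤n
  ...   | inj₂ ri rewrite ri = ℕₚ.m≤n+m 1 (𝟙 (q i))

count≤length : ∀ {I : Set} (p : I → Bool) is → count p is ≤ length is
count≤length p []       = z≤n
count≤length p (i ∷ is) with p i
... | true  = s≤s (count≤length p is)
... | false = ℕₚ.m≤n⇒m≤1+n (count≤length p is)

count≡0 : ∀ {I : Set} (p : I → Bool) is → count p is ≡ 0 → ∀ {i} → i ∈ is → p i ≡ false
count≡0 p (i ∷ is) eq (here refl) with p i
... | false = refl
count≡0 p (i ∷ is) eq (there i∈) = count≡0 p is (ℕₚ.m+n≡0⇒n≡0 (𝟙 (p i)) eq) i∈

-- The averaging argument that replaces a random choice: were every term positive, the sum would be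
-- positive too.
∑-nonpositive-term : ∀ {I : Set} (is : List I) (f : I → ℤ) → 1 ≤ length is → ∑ is f ≤ᶻ 0ℤ → ∃[ i ] f i ≤ᶻ 0ℤ
∑-nonpositive-term (i ∷ is) f _ le with f i ℤₚ.≤? 0ℤ
... | yes fi≤0 = i , fi≤0
... | no  fi≰0 with is
...   | []     = i , subst (_≤ᶻ 0ℤ) (ℤₚ.+-identityʳ (f i)) le
...   | j ∷ js = ∑-nonpositive-term (j ∷ js) f (s≤s z≤n)
          (ℤₚ.≤-trans (subst (_≤ᶻ f i +ᶻ ∑ (j ∷ js) f) (ℤₚ.+-identityˡ _) (ℤₚ.+-monoˡ-≤ _ (ℤₚ.<⇒≤ (ℤₚ.≰⇒> fi≰0)))) le)

dot-comm : ∀ {n} (u v : Vec Bool n) → dot u v ≡ dot v u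
dot-comm []      []      = refl
dot-comm (a ∷ u) (b ∷ v) = cong₂ _xor_ (Boolₚ.∧-comm a b) (dot-comm u v)

isZero : ∀ {n} → Vec Bool n → Bool
isZero []      = true
isZero (b ∷ u) = not b ∧ isZero u

isZero-sound : ∀ {n} (u : Vec Bool n) → isZero u ≡ true → u ≡ 𝟘
isZero-sound []          _  = refl
isZero-sound (false ∷ u) eq = cong (false ∷_) (isZero-sound u eq)

isZero-𝟘 : ∀ n → isZero (𝟘 {n}) ≡ true
isZero-𝟘 zero    = refl
isZero-𝟘 (suc n) = isZero-𝟘 n

isZero-complete : ∀ {n} {u : Vec Bool n} → u ≢ 𝟘 → isZero u ≡ false
isZero-complete {u = u} u≢𝟘 with isZero u in eq
... | true  = ⊥-elim (u≢𝟘 (isZero-sound u eq))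
... | false = refl

cube-nonempty : ∀ n → 1 ≤ length (cube n)
cube-nonempty n = subst (1 ≤_) (sym (length-cube n)) (ℕₚ.m^n>0 2 n)

-- On average over a, the bit c xor ⟨a , u⟩ vanishes for half of the pairs with u ≢ 𝟘.
halving-row : ∀ {I : Set} {q} (is : List I) (c : I → Bool) (u : I → Vec Bool q) (r : I → Bool) →
  (∀ i → r i ≡ true → u i ≢ 𝟘) →
  ∃[ a ] 2 * count (λ i → r i ∧ not (c i xor dot a (u i))) is ≤ count r is
halving-row {I} {q} is c u r u≢𝟘 = a , ℤₚ.drop‿+≤+ (subst (_≤ᶻ + count r is) (sym (ℤₚ.pos-* 2 (count (λ i → r i ∧ not (c i xor dot a (u i))) is)))
    (ℤₚ.0≤i-j⇒j≤i (subst (0ℤ ≤ᶻ_) (trans (cong -ᶻ_ (bias is)) (negate (+ 2 *ᶻ + count (λ i → r i ∧ not (c i xor dot a (u i))) is) (+ count r is)))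
      (ℤₚ.neg-mono-≤ biased))))
  where
  negate : ∀ x y → -ᶻ (x -ᶻ y) ≡ y -ᶻ x
  negate = solve-∀
  signed : Vec Bool q → I → ℤ
  signed a i = ⟦ r i ⟧ *ᶻ sgn (c i xor dot a (u i))
  balanced : ∀ i → ∑ (cube q) (λ a → signed a i) ≡ 0ℤ
  balanced i with r i in ri
  ... | false = ∑-zero (cube q) (λ _ → refl)
  ... | true  = trans (∑-cong (cube q) (λ a → trans (ℤₚ.*-identityˡ (sgn (c i xor dot a (u i))))
                        (trans (sgn-xor (c i) (dot a (u i))) (cong (λ b → sgn (c i) *ᶻ sgn b) (dot-comm a (u i))))))
                  (trans (∑-*ˡ (cube q) (sgn (c i)) (χ (u i))) (trans (cong (sgn (c i) *ᶻ_) (∑-χ (u i) (u≢𝟘 i ri))) (ℤₚ.*-zeroʳ (sgn (c i)))))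
  witness : ∃[ a ] ∑ is (signed a) ≤ᶻ 0ℤ
  witness = ∑-nonpositive-term (cube q) (λ a → ∑ is (signed a)) (cube-nonempty q)
    (ℤₚ.≤-reflexive (trans (∑-swap (cube q) is signed) (∑-zero is balanced)))
  a : Vec Bool q
  a = proj₁ witness
  biased : ∑ is (signed a) ≤ᶻ 0ℤ
  biased = proj₂ witness
  bias : ∀ is → ∑ is (signed a) ≡ + 2 *ᶻ + count (λ i → r i ∧ not (c i xor dot a (u i))) is -ᶻ + count r is
  bias []       = refl
  bias (i ∷ is) = trans (cong₂ _+ᶻ_ (term (r i) (c i xor dot a (u i))) (bias is))
    (regroup (+ 𝟙 (r i ∧ not (c i xor dot a (u i)))) (+ 𝟙 (r i)) (+ count (λ i → r i ∧ not (c i xor dot a (u i))) is) (+ count r is))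
    where
    term : ∀ r e → ⟦ r ⟧ *ᶻ sgn e ≡ + 2 *ᶻ + 𝟙 (r ∧ not e) -ᶻ + 𝟙 r
    term false e     = refl
    term true  true  = refl
    term true  false = refl
    regroup : ∀ a b c d → (+ 2 *ᶻ a -ᶻ b) +ᶻ (+ 2 *ᶻ c -ᶻ d) ≡ + 2 *ᶻ (a +ᶻ c) -ᶻ (b +ᶻ d)
    regroup = solve-∀

Matrix : ℕ → ℕ → Set
Matrix p q = Vec (Vec Bool q) p

infixr 7 _·_
_·_ : ∀ {p q} → Matrix p q → Vec Bool q → Vec Bool p
A · v = Vec.map (λ a → dot a v) A

·-⊕ : ∀ {p q} (A : Matrix p q) u v → A · (u ⊕ v) ≡ A · u ⊕ A · v
·-⊕ []      u v = refl
·-⊕ (a ∷ A) u v = cong₂ _∷_ (dot-⊕ʳ a u v) (·-⊕ A u v)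

·-𝟘 : ∀ {p q} (A : Matrix p q) → A · 𝟘 ≡ 𝟘
·-𝟘 []      = refl
·-𝟘 (a ∷ A) = cong₂ _∷_ (dot-𝟘ʳ a) (·-𝟘 A)

isZero-⊕-∷ : ∀ {p} (c : Vec Bool (suc p)) b v → isZero (c ⊕ (b ∷ v)) ≡ not (head c xor b) ∧ isZero (tail c ⊕ v)
isZero-⊕-∷ (_ ∷ _) b v = refl

-- The method of conditional expectations, one row at a time: `halving-row` gives a row for which
-- the first bit of `c i ⊕ A · u i` vanishes on at most half of the indices under consideration, and
-- only those are passed on to the choice of the remaining rows.
separating-matrix : ∀ {I : Set} p {q} (is : List I) (c : I → Vec Bool p) (u : I → Vec Bool q) (r : I → Bool) →
  (∀ i → r i ≡ true → u i ≢ 𝟘) →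
  ∃[ A ] 2 ^ p * count (λ i → r i ∧ isZero (c i ⊕ A · u i)) is ≤ count r is
separating-matrix zero    is c u r u≢𝟘 =
  [] , ℕₚ.≤-trans (ℕₚ.≤-reflexive (ℕₚ.+-identityʳ _)) (count-mono is (λ i eq → proj₁ (∧-split eq)))
separating-matrix (suc p) is c u r u≢𝟘
  with a , row ← halving-row is (head ∘ c) u r u≢𝟘
  with A , rest ← separating-matrix p is (tail ∘ c) u (λ i → r i ∧ not (head (c i) xor dot a (u i)))
                    (λ i eq → u≢𝟘 i (proj₁ (∧-split eq))) =
  a ∷ A , (begin
    2 * 2 ^ p * count (λ i → r i ∧ isZero (c i ⊕ (a ∷ A) · u i)) is
      ≡⟨ ℕₚ.*-assoc 2 (2 ^ p) _ ⟩
    2 * (2 ^ p * count (λ i → r i ∧ isZero (c i ⊕ (a ∷ A) · u i)) is)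
      ≤⟨ ℕₚ.*-monoʳ-≤ 2 (ℕₚ.*-monoʳ-≤ (2 ^ p) (count-mono is (λ i eq → trans
           (trans (Boolₚ.∧-assoc (r i) _ _) (cong (r i ∧_) (sym (isZero-⊕-∷ (c i) (dot a (u i)) (A · u i))))) eq))) ⟩
    2 * (2 ^ p * count (λ i → (r i ∧ not (head (c i) xor dot a (u i))) ∧ isZero (tail (c i) ⊕ A · u i)) is)
      ≤⟨ ℕₚ.*-monoʳ-≤ 2 rest ⟩
    2 * count (λ i → r i ∧ not (head (c i) xor dot a (u i))) is
      ≤⟨ row ⟩
    count r is ∎)
  where open ℕₚ.≤-Reasoning

lincomb : ∀ {n q} → Vec Bool n → Vec (Vec Bool q) n → Vec Bool q
lincomb []      []       = 𝟘
lincomb (b ∷ u) (v ∷ vs) = (if b then v else 𝟘) ⊕ lincomb u vs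

lincomb-++ : ∀ {m n q} (u : Vec Bool m) (u′ : Vec Bool n) (vs : Vec (Vec Bool q) m) vs′ →
  lincomb (u Vec.++ u′) (vs Vec.++ vs′) ≡ lincomb u vs ⊕ lincomb u′ vs′
lincomb-++ []      u′ []       vs′ = sym (⊕-identityˡ _)
lincomb-++ (b ∷ u) u′ (v ∷ vs) vs′ =
  trans (cong ((if b then v else 𝟘) ⊕_) (lincomb-++ u u′ vs vs′)) (sym (zipWith-assoc xor-assoc (if b then v else 𝟘) _ _))

lincomb-map : ∀ {n p q} (f : Vec Bool q → Vec Bool p) → f 𝟘 ≡ 𝟘 → (∀ v w → f (v ⊕ w) ≡ f v ⊕ f w) →
  ∀ (u : Vec Bool n) vs → lincomb u (Vec.map f vs) ≡ f (lincomb u vs)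
lincomb-map f f𝟘 f⊕ []          []       = sym f𝟘
lincomb-map f f𝟘 f⊕ (true ∷ u)  (v ∷ vs) = trans (cong (f v ⊕_) (lincomb-map f f𝟘 f⊕ u vs)) (sym (f⊕ v _))
lincomb-map f f𝟘 f⊕ (false ∷ u) (v ∷ vs) =
  trans (cong₂ _⊕_ (sym f𝟘) (lincomb-map f f𝟘 f⊕ u vs)) (sym (f⊕ 𝟘 _))

-- The adjoint identity: as a function of the seed `r`, a parity of the table of values `dot r v` is
-- a single parity of `r`.
dot-map-dot : ∀ {n q} (u : Vec Bool n) (r : Vec Bool q) vs → dot u (Vec.map (dot r) vs) ≡ dot r (lincomb u vs)
dot-map-dot []          r []       = sym (dot-𝟘ʳ r)
dot-map-dot (true ∷ u)  r (v ∷ vs) = trans (cong (dot r v xor_) (dot-map-dot u r vs)) (sym (dot-⊕ʳ r v _))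
dot-map-dot (false ∷ u) r (v ∷ vs) = trans (dot-map-dot u r vs) (cong (dot r) (sym (⊕-identityˡ _)))

-- `2 ^ suc k` unfolds to `2 ^ k + (2 ^ k + 0)`, so an empty vector follows the second half; hence
-- the trailing `[]` in `lo-hi` and `states`.
lo hi : ∀ {k} → Vec Bool (2 ^ suc k) → Vec Bool (2 ^ k)
lo {k} u = take (2 ^ k) u
hi {k} u = take (2 ^ k) (drop (2 ^ k) u)

lo-hi : ∀ {k} (u : Vec Bool (2 ^ suc k)) → u ≡ lo {k} u Vec.++ (hi {k} u Vec.++ [])
lo-hi {k} u = trans (sym (take++drop≡id (2 ^ k) u)) (cong (lo {k} u Vec.++_)
  (trans (sym (take++drop≡id (2 ^ k) (drop (2 ^ k) u))) (cong (hi {k} u Vec.++_) (empty (drop (2 ^ k) (drop (2 ^ k) u))))))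
  where
  empty : (v : Vec Bool 0) → v ≡ []
  empty [] = refl

-- Entry z is reached from the all-ones vector by reading the bits of z from the
-- last to the first, where a bit true applies v ↦ v ⊕ A · v for its matrix A.
states : ∀ {k q} → Vec (Matrix q q) k → Vec (Vec Bool q) (2 ^ k)
states []       = replicate _ true ∷ []
states (A ∷ As) = states As Vec.++ (Vec.map (λ v → v ⊕ A · v) (states As) Vec.++ [])

states-∷ : ∀ {k q} (A : Matrix q q) (As : Vec (Matrix q q) k) (u : Vec Bool (2 ^ suc k)) →
  lincomb u (states (A ∷ As)) ≡
  (lincomb (lo {k} u) (states As) ⊕ lincomb (hi {k} u) (states As)) ⊕ A · lincomb (hi {k} u) (states As)
states-∷ {k} A As u = trans (cong (λ u → lincomb u (states (A ∷ As))) (lo-hi {k} u))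
  (trans (lincomb-++ (lo {k} u) _ (states As) _)
    (trans (cong (lincomb (lo {k} u) (states As) ⊕_)
        (trans (lincomb-++ (hi {k} u) [] _ []) (trans (⊕-identityʳ _) (lincomb-map (λ v → v ⊕ A · v)
          (trans (⊕-identityˡ _) (·-𝟘 A)) (λ v w → trans (cong (v ⊕ w ⊕_) (·-⊕ A v w)) (⊕-medial v w _ _)) (hi {k} u) (states As)))))
      (sym (zipWith-assoc xor-assoc (lincomb (lo {k} u) (states As)) _ _))))

-- Chooses a half that is nonzero whenever `u` is, preferring the second one, on whose combination
-- the next matrix acts.
pick : ∀ k → Vec Bool (2 ^ suc k) → Vec Bool (2 ^ k)
pick k u = if isZero (hi {k} u) then lo {k} u else hi {k} u

𝟘-++ : ∀ m {n} → 𝟘 {m} Vec.++ 𝟘 {n} ≡ 𝟘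
𝟘-++ zero    = refl
𝟘-++ (suc m) = cong (false ∷_) (𝟘-++ m)

pick-nonzero : ∀ k u → u ≢ 𝟘 → pick k u ≢ 𝟘
pick-nonzero k u u≢𝟘 eq with isZero (hi {k} u) in hz
... | true  = u≢𝟘 (trans (lo-hi {k} u) (trans (cong₂ (λ x y → x Vec.++ (y Vec.++ [])) eq (isZero-sound _ hz))
                (trans (cong (𝟘 {2 ^ k} Vec.++_) (𝟘-++ (2 ^ k))) (𝟘-++ (2 ^ k)))))
... | false with () ← trans (sym hz) (trans (cong isZero eq) (isZero-𝟘 (2 ^ k)))

not-isZero : ∀ {n} {v : Vec Bool n} → not (isZero v) ≡ true → v ≢ 𝟘
not-isZero {n} eq refl with () ← trans (sym (cong not (isZero-𝟘 n))) eq

-- Here `w₀` and `w₁` are the combinations over the two halves. If the total vanishes with `w₁ ≢ 𝟘`,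
-- the failure is blamed on `A`. If `w₁ ≡ 𝟘`, the total is `w₀`, so both halves have a vanishing
-- combination and the earlier matrices failed already, whichever half was picked.
nonzero-either : ∀ {q} (A : Matrix q q) w₀ w₁ b r → r ∧ isZero ((w₀ ⊕ w₁) ⊕ A · w₁) ≡ true →
  r ∧ isZero (if b then w₀ else w₁) ≡ true ⊎ (r ∧ not (isZero w₁)) ∧ isZero ((w₀ ⊕ w₁) ⊕ A · w₁) ≡ true
nonzero-either A w₀ w₁ b true eq with isZero w₁ in z
... | false = inj₂ eq
nonzero-either A w₀ w₁ false true eq | true = inj₁ z
nonzero-either A w₀ w₁ true  true eq | true = inj₁ (subst (λ v → isZero v ≡ true)
  (trans (cong (λ v → (w₀ ⊕ v) ⊕ A · v) (isZero-sound w₁ z)) (trans (cong₂ _⊕_ (⊕-identityʳ w₀) (·-𝟘 A)) (⊕-identityʳ w₀))) eq)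

-- A union bound over the levels: by `separating-matrix`, each matrix adds failures on at most a
-- fraction 1 / 2^(q+1) of the indices. At `k ≡ 0` the only state is the all-ones vector, which is
-- nonzero because the dimension is `suc q`.
separating-states : ∀ {I : Set} k {q} (is : List I) (U : I → Vec Bool (2 ^ k)) (r : I → Bool) →
  (∀ i → r i ≡ true → U i ≢ 𝟘) →
  ∃[ As ] 2 ^ suc q * count (λ i → r i ∧ isZero (lincomb (U i) (states {k} {suc q} As))) is ≤ k * count r is
separating-states zero {q} is U r U≢𝟘 = [] , subst (λ m → 2 ^ suc q * m ≤ 0) (sym none) (ℕₚ.≤-reflexive (ℕₚ.*-zeroʳ (2 ^ suc q)))
  where
  nonzero : ∀ i → r i ∧ isZero (lincomb (U i) (states {0} {suc q} [])) ≡ false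
  nonzero i with r i in ri | U i in Ui
  ... | false | _          = refl
  ... | true  | true ∷ []  = refl
  ... | true  | false ∷ [] = ⊥-elim (U≢𝟘 i ri Ui)
  count-none : ∀ {I : Set} {p : I → Bool} is → (∀ i → p i ≡ false) → count p is ≡ 0
  count-none []       _  = refl
  count-none (i ∷ is) eq = cong₂ _+_ (cong 𝟙 (eq i)) (count-none is eq)
  none : count (λ i → r i ∧ isZero (lincomb (U i) (states {0} {suc q} []))) is ≡ 0
  none = count-none is nonzero
separating-states {I} (suc k) {q} is U r U≢𝟘 =
  let As , ih = separating-states k {q} is (pick k ∘ U) r (λ i ri → pick-nonzero k (U i) (U≢𝟘 i ri))
      w₀ = λ i → lincomb (lo {k} (U i)) (states As)
      w₁ = λ i → lincomb (hi {k} (U i)) (states As)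
      A , new = separating-matrix (suc q) is (λ i → w₀ i ⊕ w₁ i) w₁ (λ i → r i ∧ not (isZero (w₁ i)))
                  (λ i eq → not-isZero (proj₂ (∧-split {r i} eq)))
  in A ∷ As , accumulate (2 ^ suc q) k ih
       (ℕₚ.≤-trans new (count-mono is (λ i eq → proj₁ (∧-split eq))))
       (count-∪ is (λ i eq → Sum.map₁ (subst (λ v → r i ∧ isZero v ≡ true) (sym (if-float (λ u → lincomb u (states As)) (isZero (hi {k} (U i))))))
         (nonzero-either A (w₀ i) (w₁ i) (isZero (hi {k} (U i))) (r i) (subst (λ v → r i ∧ isZero v ≡ true) (states-∷ A As (U i)) eq))))
  where
  accumulate : ∀ p k {f f₁ f₂ c} → p * f₁ ≤ k * c → p * f₂ ≤ c → f ≤ f₁ + f₂ → p * f ≤ suc k * c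
  accumulate p k {f} {f₁} {f₂} {c} le₁ le₂ le = begin
    p * f             ≤⟨ ℕₚ.*-monoʳ-≤ p le ⟩
    p * (f₁ + f₂)     ≡⟨ ℕₚ.*-distribˡ-+ p f₁ f₂ ⟩
    p * f₁ + p * f₂   ≤⟨ ℕₚ.+-mono-≤ le₁ le₂ ⟩
    k * c + c         ≡⟨ ℕₚ.+-comm (k * c) c ⟩
    suc k * c         ∎
    where open ℕₚ.≤-Reasoning

∑-cartesian : ∀ {I J K : Set} (h : I → J → K) (is : List I) (js : List J) (f : K → ℤ) →
  ∑ (cartesianProductWith h is js) f ≡ ∑ is (λ i → ∑ js (λ j → f (h i j)))
∑-cartesian h []       js f = refl
∑-cartesian h (i ∷ is) js f = trans (∑-++ (List.map (h i) js) _ f)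
  (cong₂ _+ᶻ_ (∑-map (h i) js f) (∑-cartesian h is js f))

length-cartesian : ∀ {I J K : Set} (h : I → J → K) (is : List I) (js : List J) →
  length (cartesianProductWith h is js) ≡ length is * length js
length-cartesian h []       js = refl
length-cartesian h (i ∷ is) js = trans (length-++ (List.map (h i) js))
  (cong₂ _+_ (length-map (h i) js) (length-cartesian h is js))

module _ {k q : ℕ} where

  Block : Set
  Block = Vec (Matrix q q) k

  table : Block → Vec Bool q → Vec Bool (2 ^ k)
  table B r = Vec.map (dot r) (states B)

  -- One entry for every choice of seeds, repetitions included, so that a character sum over the
  -- list factors into one sum per block.
  generator : ∀ {b} → Vec Block b → List (Vec Bool (2 ^ k))
  generator []       = 𝟘 ∷ []
  generator (B ∷ Bs) = cartesianProductWith _⊕_ (List.map (table B) (cube q)) (generator Bs)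

  generator-nonempty : ∀ {b} (Bs : Vec Block b) → 1 ≤ length (generator Bs)
  generator-nonempty []       = s≤s z≤n
  generator-nonempty (B ∷ Bs) = subst (1 ≤_) (sym (length-cartesian _⊕_ (List.map (table B) (cube q)) (generator Bs)))
    (ℕₚ.*-mono-≤ (subst (1 ≤_) (sym (length-map (table B) (cube q))) (cube-nonempty q)) (generator-nonempty Bs))

  annihilated : ∀ {b} → Vec Block b → Vec Bool (2 ^ k) → Bool
  annihilated []       u = true
  annihilated (B ∷ Bs) u = isZero (lincomb u (states B)) ∧ annihilated Bs u

  -- The factor of a block `B` is the sum over all seeds of the character of `lincomb u (states B)`,
  -- which vanishes unless that vector is `𝟘`. Thus a single block that does not annihilate `u`
  -- suffices.
  ∑-generator : ∀ {b} (Bs : Vec Block b) u → annihilated Bs u ≡ false → ∑ (generator Bs) (χ u) ≡ 0ℤ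
  ∑-generator (B ∷ Bs) u hit = trans (∑-cartesian _⊕_ (List.map (table B) (cube q)) (generator Bs) (χ u))
    (trans (∑-map (table B) (cube q) (λ x → ∑ (generator Bs) (λ y → χ u (x ⊕ y))))
      (trans (∑-cong (cube q) (λ r → ∑-cong (generator Bs) (λ y →
          trans (χ-⊕ʳ u (table B r) y) (cong (_*ᶻ χ u y) (character r)))))
        (trans (∑-product (cube q) (generator Bs) (χ (lincomb u (states B))) (χ u)) vanish)))
    where
    character : ∀ r → χ u (table B r) ≡ χ (lincomb u (states B)) r
    character r = cong sgn (trans (dot-map-dot u r (states B)) (dot-comm r _))
    vanish : ∑ (cube q) (χ (lincomb u (states B))) *ᶻ ∑ (generator Bs) (χ u) ≡ 0ℤ
    vanish with isZero (lincomb u (states B)) in z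
    ... | true  = trans (cong (∑ (cube q) (χ (lincomb u (states B))) *ᶻ_) (∑-generator Bs u hit)) (ℤₚ.*-zeroʳ (∑ (cube q) (χ (lincomb u (states B)))))
    ... | false = cong (_*ᶻ ∑ (generator Bs) (χ u)) (∑-χ (lincomb u (states B)) λ eq → absurd (trans (sym z) (trans (cong isZero eq) (isZero-𝟘 q))))
      where
      absurd : false ≢ true
      absurd ()

n≤2^n : ∀ n → n ≤ 2 ^ n
n≤2^n zero    = z≤n
n≤2^n (suc n) = ℕₚ.+-mono-≤ (ℕₚ.m^n>0 2 n) (ℕₚ.≤-trans (n≤2^n n) (ℕₚ.m≤m+n _ _))

-- In dimension `suc k` the failures are a fraction of at most k / 2^(k+1), hence at most one half.
halving-block : ∀ k (is : List (Vec Bool (2 ^ k))) r → (∀ u → r u ≡ true → u ≢ 𝟘) →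
  ∃[ B ] 2 * count (λ u → r u ∧ isZero (lincomb u (states {k} {suc k} B))) is ≤ count r is
halving-block k is r r⇒ with B , le ← separating-states k {k} is (λ u → u) r r⇒ =
  B , ℕₚ.*-cancelˡ-≤ (2 ^ k) {{ℕₚ.m^n≢0 2 k}} (begin
    2 ^ k * (2 * f) ≡⟨ trans (sym (ℕₚ.*-assoc (2 ^ k) 2 f)) (cong (_* f) (ℕₚ.*-comm (2 ^ k) 2)) ⟩
    2 ^ suc k * f   ≤⟨ le ⟩
    k * count r is  ≤⟨ ℕₚ.*-monoˡ-≤ (count r is) (n≤2^n k) ⟩
    2 ^ k * count r is ∎)
  where
  open ℕₚ.≤-Reasoning
  f : ℕ
  f = count (λ u → r u ∧ isZero (lincomb u (states B))) is

fooling-blocks : ∀ k b (is : List (Vec Bool (2 ^ k))) r → (∀ u → r u ≡ true → u ≢ 𝟘) →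
  ∃[ Bs ] 2 ^ b * count (λ u → r u ∧ annihilated {k} {suc k} {b} Bs u) is ≤ count r is
fooling-blocks k zero    is r r⇒ =
  [] , ℕₚ.≤-trans (ℕₚ.≤-reflexive (ℕₚ.+-identityʳ _)) (count-mono is (λ u eq → proj₁ (∧-split eq)))
fooling-blocks k (suc b) is r r⇒
  with B , first ← halving-block k is r r⇒
  with Bs , rest ← fooling-blocks k b is (λ u → r u ∧ isZero (lincomb u (states B))) (λ u eq → r⇒ u (proj₁ (∧-split eq))) =
  B ∷ Bs , (begin
    2 * 2 ^ b * count (λ u → r u ∧ annihilated (B ∷ Bs) u) is
      ≡⟨ ℕₚ.*-assoc 2 (2 ^ b) _ ⟩
    2 * (2 ^ b * count (λ u → r u ∧ annihilated (B ∷ Bs) u) is)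
      ≤⟨ ℕₚ.*-monoʳ-≤ 2 (ℕₚ.*-monoʳ-≤ (2 ^ b) (count-mono is (λ u → trans (Boolₚ.∧-assoc (r u) _ _)))) ⟩
    2 * (2 ^ b * count (λ u → (r u ∧ isZero (lincomb u (states B))) ∧ annihilated Bs u) is)
      ≤⟨ ℕₚ.*-monoʳ-≤ 2 rest ⟩
    2 * count (λ u → r u ∧ isZero (lincomb u (states B))) is
      ≤⟨ first ⟩
    count r is ∎)
  where open ℕₚ.≤-Reasoning

-- Each block at least halves the number of nonzero vectors annihilated so far. Starting from fewer
-- than `2 ^ b`, fewer than one is left after `b` blocks.
fooling-generator : ∀ k b (is : List (Vec Bool (2 ^ k))) → length is < 2 ^ b →
  ∃[ Bs ] (∀ {u} → u ∈ is → u ≢ 𝟘 → ∑ (generator {k} {suc k} {b} Bs) (χ u) ≡ 0ℤ)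
fooling-generator k b is few
  with Bs , le ← fooling-blocks k b is (not ∘ isZero) (λ u → not-isZero) =
  Bs , λ {u} u∈ u≢𝟘 → ∑-generator Bs u (subst (λ z → not z ∧ annihilated Bs u ≡ false) (isZero-complete u≢𝟘)
    (count≡0 _ is (small _ (2 ^ b) (ℕₚ.≤-<-trans le (ℕₚ.≤-<-trans (count≤length _ is) few))) u∈))
  where
  small : ∀ c m → m * c < m → c ≡ 0
  small zero    m _  = refl
  small (suc c) m lt = ⊥-elim (ℕₚ.<⇒≱ lt (ℕₚ.m≤m*n m (suc c)))

-- Circuits for the generated tables

module _ {K : ℕ} where

  infix 4 _⊢_
  _⊢_ : ∀ {m} → Gates K m → ((Fin K → Bool) → Bool) → Set
  gs ⊢ f = Σ[ w ∈ Wire K _ ] (∀ x → evalWire x (evalGates x gs) w ≡ f x)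

  ⊢-cong : ∀ {m} {gs : Gates K m} {f g} → (∀ x → f x ≡ g x) → gs ⊢ f → gs ⊢ g
  ⊢-cong f≡g (w , eq) = w , λ x → trans (eq x) (f≡g x)

  -- A circuit under construction: `c` bounds the number of new gates, and `keep` carries available
  -- functions over to the longer gate list, where gate indices have shifted.
  record Extension {m} (gs : Gates K m) (c : ℕ) (P : ∀ {m′} → Gates K m′ → Set) : Set where
    constructor extension
    field
      {size′} : ℕ
      bound   : size′ ≤ c + m
      gates′  : Gates K size′
      keep    : ∀ {f} → gs ⊢ f → gates′ ⊢ f
      result  : P gates′

  done : ∀ {m} {gs : Gates K m} {P : ∀ {m′} → Gates K m′ → Set} → P gs → Extension gs 0 P
  done {gs = gs} p = extension ℕₚ.≤-refl gs (λ r → r) p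

  infixl 1 _>>=_
  _>>=_ : ∀ {m c c′} {gs : Gates K m} {P Q : ∀ {m′} → Gates K m′ → Set} → Extension gs c P →
    (∀ {m′} {gs′ : Gates K m′} → (∀ {f} → gs ⊢ f → gs′ ⊢ f) → P gs′ → Extension gs′ c′ Q) → Extension gs (c′ + c) Q
  _>>=_ {m} {c} {c′} (extension b gs′ keep p) f with extension b′ gs″ keep′ q ← f keep p =
    extension (ℕₚ.≤-trans b′ (ℕₚ.≤-trans (ℕₚ.+-monoʳ-≤ c′ b) (ℕₚ.≤-reflexive (sym (ℕₚ.+-assoc c′ c m))))) gs″ (keep′ ∘ keep) q

  mapᴱ : ∀ {m c} {gs : Gates K m} {P Q : ∀ {m′} → Gates K m′ → Set} →
    (∀ {m′} {gs′ : Gates K m′} → P gs′ → Q gs′) → Extension gs c P → Extension gs c Q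
  mapᴱ f (extension b gs′ keep p) = extension b gs′ keep (f p)

  add-gate : ∀ {m} {gs : Gates K m} (g : Gate K m) → Extension gs 1 (_⊢ λ x → evalGate x (evalGates x gs) g)
  add-gate {gs = gs} g = extension ℕₚ.≤-refl (gs ▷ g)
    (λ { (input i , eq) → input i , eq ; (const b , eq) → const b , eq ; (gate j , eq) → gate (suc j) , eq })
    (gate zero , λ x → refl)

  add-and : ∀ {m} {gs : Gates K m} {f g} → gs ⊢ f → gs ⊢ g → Extension gs 1 (_⊢ λ x → f x ∧ g x)
  add-and (u , u≡) (v , v≡) = mapᴱ (λ {_} {gs} → ⊢-cong {gs = gs} (λ x → cong₂ _∧_ (u≡ x) (v≡ x))) (add-gate (and u v))

  add-or : ∀ {m} {gs : Gates K m} {f g} → gs ⊢ f → gs ⊢ g → Extension gs 1 (_⊢ λ x → f x ∨ g x)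
  add-or (u , u≡) (v , v≡) = mapᴱ (λ {_} {gs} → ⊢-cong {gs = gs} (λ x → cong₂ _∨_ (u≡ x) (v≡ x))) (add-gate (or u v))

  add-neg : ∀ {m} {gs : Gates K m} {f} → gs ⊢ f → Extension gs 1 (_⊢ λ x → not (f x))
  add-neg (u , u≡) = mapᴱ (λ {_} {gs} → ⊢-cong {gs = gs} (λ x → cong not (u≡ x))) (add-gate (neg u))

  add-xor : ∀ {m} {gs : Gates K m} {f g} → gs ⊢ f → gs ⊢ g → Extension gs 4 (_⊢ λ x → f x xor g x)
  add-xor {f = f} {g} ⊢f ⊢g = mapᴱ (λ {_} {gs} → ⊢-cong {gs = gs} (λ x → sym (Boolₚ.xor-is-ok (f x) (g x))))
    (add-and ⊢f ⊢g >>= λ k₁ ⊢∧ → add-neg ⊢∧ >>= λ k₂ ⊢¬ →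
     add-or (k₂ (k₁ ⊢f)) (k₂ (k₁ ⊢g)) >>= λ k₃ ⊢∨ → add-and ⊢∨ (k₃ ⊢¬))

  at : ∀ {q} → (Fin K → Bool) → Vec ((Fin K → Bool) → Bool) q → Vec Bool q
  at x = Vec.map (λ f → f x)

  add-dot : ∀ {m q} {gs : Gates K m} (a : Vec Bool q) fs → Allᵥ (gs ⊢_) fs →
    Extension gs (q * 4) (_⊢ λ x → dot a (at x fs))
  add-dot []          []       []         = done (const false , λ x → refl)
  add-dot (true ∷ a)  (f ∷ fs) (⊢f ∷ ⊢fs) = add-dot a fs ⊢fs >>= λ k ⊢dot → add-xor (k ⊢f) ⊢dot
  add-dot (false ∷ a) (f ∷ fs) (⊢f ∷ ⊢fs) with extension b gs′ keep r ← add-dot a fs ⊢fs =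
    extension (ℕₚ.≤-trans b (ℕₚ.m≤n+m _ 4)) gs′ keep r

  -- Conditional addition of `A` applied to `fs`, with selector `z`. In use `fs` and `gs` coincide;
  -- they are separate here because the recursion runs along `gs` while every row of `A` reads all
  -- of `fs`.
  update : ∀ {p q} → ((Fin K → Bool) → Bool) → Matrix p q → Vec ((Fin K → Bool) → Bool) q →
    Vec ((Fin K → Bool) → Bool) p → Vec ((Fin K → Bool) → Bool) p
  update z A fs gs = zipWith (λ a g x → g x xor (z x ∧ dot a (at x fs))) A gs

  at-update : ∀ {p q} z (A : Matrix p q) fs gs x → at x (update z A fs gs) ≡ (if z x then at x gs ⊕ A · at x fs else at x gs)
  at-update z []      fs []       x with z x
  ... | true  = refl
  ... | false = refl
  at-update z (a ∷ A) fs (g ∷ gs) x with z x | at-update z A fs gs x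
  ... | true  | ih = cong ((g x xor dot a (at x fs)) ∷_) ih
  ... | false | ih = cong₂ _∷_ (xor-identityʳ (g x)) ih

  add-update : ∀ {m p q} {gs : Gates K m} z (A : Matrix p q) fs hs → gs ⊢ z → Allᵥ (gs ⊢_) fs → Allᵥ (gs ⊢_) hs →
    Extension gs (p * (5 + q * 4)) (λ gs′ → Allᵥ (gs′ ⊢_) (update z A fs hs))
  add-update z []      fs []       ⊢z ⊢fs []         = done []
  add-update {q = q} z (a ∷ A) fs (h ∷ hs) ⊢z ⊢fs (⊢h ∷ ⊢hs) =
    add-update z A fs hs ⊢z ⊢fs ⊢hs >>= λ k₁ ⊢rest →
    (add-dot a fs (Allᵥ.map k₁ ⊢fs) >>= λ k₂ ⊢dot →
     (add-and (k₂ (k₁ ⊢z)) ⊢dot >>= λ k₃ ⊢∧ →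
      (add-xor (k₃ (k₂ (k₁ ⊢h))) ⊢∧ >>= λ k₄ ⊢xor → done (⊢xor ∷ Allᵥ.map (k₄ ∘ k₃ ∘ k₂) ⊢rest))))

index : ∀ {k} → (Fin k → Bool) → Fin (2 ^ k)
index z = funToFin (Inverse.from 2↔Bool ∘ z)

-- Coordinate zero is the most significant bit: it selects the half of the state vector, and its
-- matrix is applied last.
lookup-states : ∀ {k q} (A : Matrix q q) (As : Vec (Matrix q q) k) (z : Fin (suc k) → Bool) →
  lookup (states (A ∷ As)) (index z) ≡
  (let v = lookup (states As) (index (z ∘ suc)) in if z zero then v ⊕ A · v else v)
lookup-states {k} A As z with z zero
... | false = lookup-++ˡ (states As) _ (index (z ∘ suc))
... | true  = trans (lookup-++ʳ (states As) _ (index (z ∘ suc) ↑ˡ 0))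
  (trans (lookup-++ˡ (Vec.map (λ v → v ⊕ A · v) (states As)) [] (index (z ∘ suc))) (lookup-map (index (z ∘ suc)) _ (states As)))

module _ {K : ℕ} where

  -- A single state is computed by `k` conditional matrix-vector products, at a cost polynomial in
  -- `k` and `q` although there are `2 ^ k` states.
  add-states : ∀ {k q m} {gs : Gates K m} (As : Vec (Matrix q q) k) (z : Fin k → (Fin K → Bool) → Bool) → (∀ i → gs ⊢ z i) →
    Extension gs (k * (q * (5 + q * 4))) (λ gs′ → Σ[ fs ∈ Vec _ q ] (Allᵥ (gs′ ⊢_) fs ×
      (∀ x → at x fs ≡ lookup (states As) (index (λ i → z i x)))))
  add-states {q = q} []       z ⊢z = done (replicate q (λ _ → true) , trues q , λ x → at-trues x q)
    where
    trues : ∀ {m} {gs : Gates K m} q → Allᵥ (gs ⊢_) (replicate q (λ _ → true))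
    trues zero    = []
    trues (suc q) = (const true , λ x → refl) ∷ trues q
    at-trues : ∀ x q → at {K} x (replicate q (λ _ → true)) ≡ replicate q true
    at-trues x zero    = refl
    at-trues x (suc q) = cong (true ∷_) (at-trues x q)
  add-states (A ∷ As) z ⊢z = add-states As (z ∘ suc) (⊢z ∘ suc) >>= λ { k (fs , ⊢fs , fs≡) →
    mapᴱ (λ ⊢up → update (z zero) A fs fs , ⊢up , λ x → trans (at-update (z zero) A fs fs x)
        (trans (cong (λ v → if z zero x then v ⊕ A · v else v) (fs≡ x)) (sym (lookup-states A As (λ i → z i x)))))
      (add-update (z zero) A fs fs (k (⊢z zero)) ⊢fs ⊢fs) }

  -- The term with `K` pays for the state, `q * 4` for its inner product with the seed, and 4 for
  -- the addition to the other blocks.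
  block-cost : ℕ → ℕ
  block-cost q = 4 + (q * 4 + K * (q * (5 + q * 4)))

  add-generator : ∀ {q m b} {gs : Gates K m} (Bs : Vec (Block {K} {q}) b) {a} → a ∈ generator Bs →
    Extension gs (b * block-cost q) (_⊢ fromTruthTable K a)
  add-generator []       (here refl) = done (const false , λ x → sym (lookup-replicate (index x) false))
  add-generator {q} (B ∷ Bs) a∈ with ∈-cartesianProductWith⁻ _⊕_ (List.map (table B) (cube q)) (generator Bs) a∈
  ... | t , u , t∈ , u∈ , refl with r , _ , refl ← ∈-map⁻ (table B) t∈ =
    add-generator Bs u∈ >>= λ _ ⊢u →
    (add-states B (λ i x → x i) (λ i → input i , λ x → refl) >>= λ { k₁ (fs , ⊢fs , fs≡) →
     add-dot r fs ⊢fs >>= λ k₂ ⊢dot →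
     mapᴱ (λ {_} {gs} → ⊢-cong {gs = gs} (λ x → trans
         (cong (_xor lookup u (index x)) (trans (cong (dot r) (fs≡ x)) (sym (lookup-map (index x) (dot r) (states B)))))
         (sym (lookup-zipWith _xor_ (index x) (table B r) u))))
       (add-xor ⊢dot (k₂ (k₁ ⊢u))) })

  generator-complexity : ∀ {q b} (Bs : Vec (Block {K} {q}) b) {a} → a ∈ generator Bs →
    CircuitComplexity≤ (fromTruthTable K a) (b * block-cost q)
  generator-complexity Bs a∈ with extension {m} bound gs _ (w , eq) ← add-generator {gs = []} Bs a∈ =
    m , ℕₚ.≤-trans bound (ℕₚ.≤-reflexive (ℕₚ.+-identityʳ _)) , record { gates = gs ; output = w } , eq

-- Counting circuits

length-allFin : ∀ n → length (List.allFin n) ≡ n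
length-allFin n = length-tabulate {n = n} (λ i → i)

module _ {k : ℕ} where

  wires : ∀ m → List (Wire k m)
  wires m = const true ∷ const false ∷ List.map input (List.allFin k) ++ List.map gate (List.allFin m)

  ∈-wires : ∀ {m} (w : Wire k m) → w ∈ wires m
  ∈-wires (const true)  = here refl
  ∈-wires (const false) = there (here refl)
  ∈-wires (input i)     = there (there (∈-++⁺ˡ (∈-map⁺ input (∈-allFin i))))
  ∈-wires (gate j)      = there (there (∈-++⁺ʳ (List.map input (List.allFin k)) (∈-map⁺ gate (∈-allFin j))))

  length-wires : ∀ m → length (wires m) ≡ 2 + (k + m)
  length-wires m = cong (λ c → 2 + c) (trans (length-++ (List.map input (List.allFin k)))
    (cong₂ _+_ (trans (length-map input (List.allFin k)) (length-allFin k))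
               (trans (length-map gate (List.allFin m)) (length-allFin m))))

  single-gates : ∀ m → List (Gate k m)
  single-gates m = cartesianProductWith and (wires m) (wires m) ++
    (cartesianProductWith or (wires m) (wires m) ++ List.map neg (wires m))

  ∈-single-gates : ∀ {m} (g : Gate k m) → g ∈ single-gates m
  ∈-single-gates (and u v) = ∈-++⁺ˡ (∈-cartesianProductWith⁺ and (∈-wires u) (∈-wires v))
  ∈-single-gates {m} (or u v) = ∈-++⁺ʳ (cartesianProductWith and (wires m) (wires m))
    (∈-++⁺ˡ (∈-cartesianProductWith⁺ or (∈-wires u) (∈-wires v)))
  ∈-single-gates {m} (neg u) = ∈-++⁺ʳ (cartesianProductWith and (wires m) (wires m))
    (∈-++⁺ʳ (cartesianProductWith or (wires m) (wires m)) (∈-map⁺ neg (∈-wires u)))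

  gate-lists : ∀ m → List (Gates k m)
  gate-lists zero    = [] ∷ []
  gate-lists (suc m) = cartesianProductWith _▷_ (gate-lists m) (single-gates m)

  ∈-gate-lists : ∀ {m} (gs : Gates k m) → gs ∈ gate-lists m
  ∈-gate-lists []       = here refl
  ∈-gate-lists (gs ▷ g) = ∈-cartesianProductWith⁺ _▷_ (∈-gate-lists gs) (∈-single-gates g)

  truth-table : ∀ {m} → Gates k m → Wire k m → Vec Bool (2 ^ k)
  truth-table gs w = tabulate (λ i → evalCircuit (record { gates = gs ; output = w }) (Inverse.to 2↔Bool ∘ finToFun i))

  tables : ℕ → List (Vec Bool (2 ^ k))
  tables-of-size : ℕ → List (Vec Bool (2 ^ k))
  tables-of-size m = cartesianProductWith truth-table (gate-lists m) (wires m)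
  tables zero    = tables-of-size zero
  tables (suc m) = tables-of-size (suc m) ++ tables m

  tables-of-size⊆tables : ∀ {m ℓ t} → m ≤ ℓ → t ∈ tables-of-size m → t ∈ tables ℓ
  tables-of-size⊆tables {ℓ = zero}  z≤n  t∈ = t∈
  tables-of-size⊆tables {m} {suc ℓ} m≤ℓ t∈ with ℕₚ.m≤n⇒m<n∨m≡n m≤ℓ
  ... | inj₁ (s≤s m≤ℓ′) = ∈-++⁺ʳ (tables-of-size (suc ℓ)) (tables-of-size⊆tables m≤ℓ′ t∈)
  ... | inj₂ refl       = ∈-++⁺ˡ t∈

  funToFin-cong : ∀ {m n} {f g : Fin m → Fin n} → (∀ i → f i ≡ g i) → funToFin f ≡ funToFin g
  funToFin-cong {zero}  eq = refl
  funToFin-cong {suc m} eq = cong₂ combine (eq zero) (funToFin-cong (eq ∘ suc))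

  easy∈tables : ∀ t ℓ → CircuitComplexity≤ (fromTruthTable k t) ℓ → t ∈ tables ℓ
  easy∈tables t ℓ (m , m≤ℓ , C , eq) = tables-of-size⊆tables m≤ℓ
    (subst (_∈ tables-of-size m) t≡ (∈-cartesianProductWith⁺ truth-table (∈-gate-lists (Circuit.gates C)) (∈-wires (Circuit.output C))))
    where
    t≡ : truth-table (Circuit.gates C) (Circuit.output C) ≡ t
    t≡ = trans (tabulate-cong (λ i → trans (eq (Inverse.to 2↔Bool ∘ finToFun i)) (cong (lookup t)
           (trans (funToFin-cong (λ j → Inverse.strictlyInverseʳ 2↔Bool (finToFun {2} {k} i j))) (funToFin-finToFin {k} {2} i)))))
         (tabulate∘lookup t)

  module _ {ℓ W G : ℕ} (wide : 2 + (k + ℓ) ≤ W) (W²≤G : W * W + (W * W + W) ≤ G) where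

    wires≤W : ∀ {m} → m ≤ ℓ → length (wires m) ≤ W
    wires≤W {m} m≤ℓ = ℕₚ.≤-trans (ℕₚ.≤-reflexive (length-wires m)) (ℕₚ.≤-trans (ℕₚ.+-monoʳ-≤ 2 (ℕₚ.+-monoʳ-≤ k m≤ℓ)) wide)

    single-gates≤G : ∀ {m} → m ≤ ℓ → length (single-gates m) ≤ G
    single-gates≤G {m} m≤ℓ = ℕₚ.≤-trans (ℕₚ.≤-reflexive
        (trans (length-++ (cartesianProductWith and (wires m) (wires m))) (cong₂ _+_ (length-cartesian and (wires m) (wires m))
          (trans (length-++ (cartesianProductWith or (wires m) (wires m))) (cong₂ _+_ (length-cartesian or (wires m) (wires m)) (length-map neg (wires m)))))))
      (ℕₚ.≤-trans (ℕₚ.+-mono-≤ (ℕₚ.*-mono-≤ w≤ w≤) (ℕₚ.+-mono-≤ (ℕₚ.*-mono-≤ w≤ w≤) w≤)) W²≤G)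
      where
      w≤ : length (wires m) ≤ W
      w≤ = wires≤W m≤ℓ

    gate-lists≤ : ∀ {m} → m ≤ ℓ → length (gate-lists m) ≤ G ^ m
    gate-lists≤ {zero}  m≤ℓ = s≤s z≤n
    gate-lists≤ {suc m} m<ℓ = ℕₚ.≤-trans (ℕₚ.≤-reflexive (length-cartesian _▷_ (gate-lists m) (single-gates m)))
      (ℕₚ.≤-trans (ℕₚ.*-mono-≤ (gate-lists≤ m≤ℓ) (single-gates≤G m≤ℓ)) (ℕₚ.≤-reflexive (ℕₚ.*-comm (G ^ m) G)))
      where
      m≤ℓ : m ≤ ℓ
      m≤ℓ = ℕₚ.<⇒≤ m<ℓ

    tables-of-size≤ : ∀ {m} → m ≤ ℓ → length (tables-of-size m) ≤ G ^ m * W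
    tables-of-size≤ {m} m≤ℓ = ℕₚ.≤-trans (ℕₚ.≤-reflexive (length-cartesian truth-table (gate-lists m) (wires m)))
      (ℕₚ.*-mono-≤ (gate-lists≤ m≤ℓ) (wires≤W m≤ℓ))

    1+W≤G : 1 + W ≤ G
    1+W≤G = ℕₚ.≤-trans (ℕₚ.+-mono-≤ (ℕₚ.*-mono-≤ 1≤W 1≤W) (ℕₚ.m≤n+m W (W * W))) W²≤G
      where
      1≤W : 1 ≤ W
      1≤W = ℕₚ.≤-trans (s≤s z≤n) wide

    -- The choice of the output wire and the circuits of smaller size together cost a factor
    -- `1 + W`, which one extra factor `G` absorbs.
    tables≤ : ∀ {m} → m ≤ ℓ → length (tables m) ≤ G ^ suc m
    tables≤ {zero}  m≤ℓ = ℕₚ.≤-trans (tables-of-size≤ m≤ℓ)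
      (ℕₚ.≤-trans (ℕₚ.≤-reflexive (ℕₚ.*-identityˡ W)) (ℕₚ.≤-trans (ℕₚ.<⇒≤ 1+W≤G) (ℕₚ.≤-reflexive (sym (ℕₚ.*-identityʳ G)))))
    tables≤ {suc m} m<ℓ = begin
      length (tables-of-size (suc m) ++ tables m)        ≡⟨ length-++ (tables-of-size (suc m)) ⟩
      length (tables-of-size (suc m)) + length (tables m) ≤⟨ ℕₚ.+-mono-≤ (tables-of-size≤ m<ℓ) (tables≤ (ℕₚ.<⇒≤ m<ℓ)) ⟩
      G ^ suc m * W + G ^ suc m                          ≡⟨ trans (ℕₚ.+-comm _ (G ^ suc m)) (sym (ℕₚ.*-suc (G ^ suc m) W)) ⟩
      G ^ suc m * suc W                                  ≤⟨ ℕₚ.*-monoʳ-≤ (G ^ suc m) 1+W≤G ⟩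
      G ^ suc m * G                                      ≡⟨ ℕₚ.*-comm (G ^ suc m) G ⟩
      G ^ suc (suc m)                                    ∎
      where open ℕₚ.≤-Reasoning

module _ {n : ℕ} where

  _≟ᵥ_ : (u v : Vec Bool n) → Dec (u ≡ v)
  _≟ᵥ_ = ≡-dec Boolₚ._≟_

  -- Double counting of the pairs of a point and an equal entry of `L`: an accepted point has at
  -- least one such entry, and an entry equals exactly one point.
  mass≤length : ∀ (φ : Vec Bool n → Bool) L → (∀ x → φ x ≡ true → x ∈ L) → mass (cube n) φ ≤ᶻ + length L
  mass≤length φ L φ⊆L = ℤₚ.≤-trans (∑-mono (cube n) covered)
    (ℤₚ.≤-reflexive (trans (∑-swap (cube n) L (λ x y → ⟦ does (x ≟ᵥ y) ⟧))
      (trans (∑-cong L (λ y → trans (∑-cube-single y _ (λ x y≢x → cong ⟦_⟧ (dec-false (x ≟ᵥ y) (y≢x ∘ sym))))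
                                    (cong ⟦_⟧ (dec-true (y ≟ᵥ y) refl))))
        (trans (∑-const L 1ℤ) (ℤₚ.*-identityˡ (+ length L))))))
    where
    member : ∀ x L → x ∈ L → 1ℤ ≤ᶻ ∑ L (λ y → ⟦ does (x ≟ᵥ y) ⟧)
    member x (y ∷ L) (here eq)  = ℤₚ.≤-trans (ℤₚ.≤-reflexive (sym (cong ⟦_⟧ (dec-true (x ≟ᵥ y) eq))))
      (ℤₚ.≤-trans (ℤₚ.≤-reflexive (sym (ℤₚ.+-identityʳ _))) (ℤₚ.+-monoʳ-≤ ⟦ does (x ≟ᵥ y) ⟧ (∑-nonneg L (λ z → ⟦⟧-nonneg (does (x ≟ᵥ z))))))
    member x (y ∷ L) (there x∈) = ℤₚ.+-mono-≤ (⟦⟧-nonneg (does (x ≟ᵥ y))) (member x L x∈)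
    covered : ∀ x → ⟦ φ x ⟧ ≤ᶻ ∑ L (λ y → ⟦ does (x ≟ᵥ y) ⟧)
    covered x with φ x in φx
    ... | true  = member x L (φ⊆L x φx)
    ... | false = ∑-nonneg L (λ y → ⟦⟧-nonneg (does (x ≟ᵥ y)))

  majority-rejected : ∀ (φ : Vec Bool n → Bool) L → (∀ x → φ x ≡ true → x ∈ L) → 2 * length L ≤ 2 ^ n →
    + length (cube n) ≤ᶻ + 2 *ᶻ mass (cube n) (not ∘ φ)
  majority-rejected φ L φ⊆L small = ℤₚ.0≤i-j⇒j≤i (subst (0ℤ ≤ᶻ_) (trans (cong (_-ᶻ + 2 *ᶻ mass (cube n) φ) total) (rearrange total))
      (ℤₚ.i≤j⇒0≤j-i (ℤₚ.≤-trans (ℤₚ.*-monoˡ-≤-nonNeg (+ 2) (mass≤length φ L φ⊆L))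
        (subst (_≤ᶻ + length (cube n)) (ℤₚ.pos-* 2 (length L)) (+≤+ (subst (2 * length L ≤_) (sym (length-cube n)) small))))))
    where
    total : + length (cube n) ≡ mass (cube n) φ +ᶻ mass (cube n) (not ∘ φ)
    total = trans (sym (trans (∑-const (cube n) 1ℤ) (ℤₚ.*-identityˡ (+ length (cube n)))))
      (mass-split (cube n) (λ _ → true) φ)
    arith : ∀ a b → (a +ᶻ b) -ᶻ + 2 *ᶻ a ≡ + 2 *ᶻ b -ᶻ (a +ᶻ b)
    arith = solve-∀
    rearrange : + length (cube n) ≡ mass (cube n) φ +ᶻ mass (cube n) (not ∘ φ) →
      (mass (cube n) φ +ᶻ mass (cube n) (not ∘ φ)) -ᶻ + 2 *ᶻ mass (cube n) φ ≡ + 2 *ᶻ mass (cube n) (not ∘ φ) -ᶻ + length (cube n)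
    rearrange eq = trans (arith (mass (cube n) φ) (mass (cube n) (not ∘ φ))) (cong (λ N → + 2 *ᶻ mass (cube n) (not ∘ φ) -ᶻ N) (sym eq))

-- Restriction to the instances

dot-++ : ∀ {m n} (u : Vec Bool m) {v : Vec Bool n} x {y} → dot (u Vec.++ v) (x Vec.++ y) ≡ dot u x xor dot v y
dot-++ []      []      = refl
dot-++ (a ∷ u) (b ∷ x) = trans (cong (a ∧ b xor_) (dot-++ u x)) (sym (xor-assoc (a ∧ b) (dot u x) _))

Affine : ∀ {n} → (Vec Bool n → Bool) → Set
Affine {n} f = Σ[ u ∈ Vec Bool n ] Σ[ c ∈ Bool ] (∀ x → f x ≡ c xor dot u x)

-- The fixed part `w` of the input contributes a constant bit, which joins `c`. So a formula over
-- parities of the whole input becomes, without growing, one over parities of the truth table.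
affine-++ˡ : ∀ m {n} {f : Vec Bool (m + n) → Bool} (w : Vec Bool m) → Affine f → Affine (λ x → f (w Vec.++ x))
affine-++ˡ m w (u , c , f≡) with u₁ , u₂ , refl ← Vec.splitAt m u =
  u₂ , c xor dot u₁ w , λ x → trans (f≡ _) (trans (cong (c xor_) (dot-++ u₁ w)) (sym (xor-assoc c (dot u₁ w) (dot u₂ x))))

affine-++ʳ : ∀ m {n} {f : Vec Bool (m + n) → Bool} (w : Vec Bool n) → Affine f → Affine (λ x → f (x Vec.++ w))
affine-++ʳ m w (u , c , f≡) with u₁ , u₂ , refl ← Vec.splitAt m u =
  u₁ , c xor dot u₂ w , λ x → trans (f≡ _) (trans (cong (c xor_) (trans (dot-++ u₁ x) (xor-comm (dot u₁ x) (dot u₂ w))))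
    (sym (xor-assoc c (dot u₂ w) (dot u₁ x))))

evalFormula-cong : ∀ {s} (F : Formula s) {y z} → (∀ i → y i ≡ z i) → evalFormula F y ≡ evalFormula F z
evalFormula-cong (leaf i)  eq = eq i
evalFormula-cong (and F G) eq = cong₂ _∧_ (evalFormula-cong F eq) (evalFormula-cong G eq)
evalFormula-cong (or F G)  eq = cong₂ _∨_ (evalFormula-cong F eq) (evalFormula-cong G eq)
evalFormula-cong (neg F)   eq = cong not (evalFormula-cong F eq)

length-ball : ∀ {n s} (S : Fin s → Vec Bool n) negated d → length (Adversary.ball S negated d) ≡ suc s ^ d
length-ball S negated zero    = refl
length-ball {s = s} S negated (suc d) = trans (length-cartesian _⊕_ (Adversary.ball S negated d) (𝟘 ∷ List.tabulate S))
  (trans (cong₂ _*_ (length-ball S negated d) (cong suc (length-tabulate S))) (ℕₚ.*-comm (suc s ^ d) (suc s)))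

module _ (k ℓ p : ℕ) where

  instance-length : ℕ
  instance-length = k + suc (2 ^ k + (ℓ + p))

  instance-string : Vec Bool (2 ^ k) → Vec Bool instance-length
  instance-string t = replicate k true Vec.++ (false ∷ (t Vec.++ (replicate ℓ true Vec.++ replicate p false)))

  toList-instance-string : ∀ t → toList (instance-string t) ≡ encode k t ℓ p
  toList-instance-string t = trans (toList-++ (replicate k true) _) (cong₂ _++_ (toList-replicate k true)
    (cong (false ∷_) (trans (toList-++ t _) (cong (toList t ++_)
      (trans (toList-++ (replicate ℓ true) _) (cong₂ _++_ (toList-replicate ℓ true) (toList-replicate p false)))))))

  affine-on-instances : (g : ParityGate instance-length) → Affine (evalParity g ∘ instance-string)
  affine-on-instances g = affine-++ʳ (2 ^ k) (replicate ℓ true Vec.++ replicate p false)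
    (affine-++ˡ 1 {f = λ x → evalParity g (replicate k true Vec.++ x)} (false ∷ [])
      (affine-++ˡ k {f = evalParity g} (replicate k true) (ParityGate.support g , ParityGate.negated g , λ x → refl)))

  MCSP-bound : ∀ {s d b W G} {φ : Vec Bool instance-length → Bool} → FORMULA[ s ]∘XOR φ → ComputesMCSP φ →
    suc s ^ d * suc s ^ d < 2 ^ b →
    b * block-cost {k} (suc k) ≤ ℓ →
    2 + (k + ℓ) ≤ W → W * W + (W * W + W) ≤ G → 2 * G ^ suc ℓ ≤ 2 ^ (2 ^ k) →
    2 * (d * d) ≤ s
  MCSP-bound {s} {d} {b} {φ = φ} (F , g , size≤s , φ≡) mcsp few-sums cheap wide W²≤G scarce =
    ℕₚ.≤-trans (adversary-bound S negated d R orthogonal F accepts (generator-nonempty Bs)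
      (majority-rejected (eval F) (tables {k} ℓ) (λ t eq → easy∈tables t ℓ (Equivalence.to (spec t) eq))
        (ℕₚ.≤-trans (ℕₚ.*-monoʳ-≤ 2 (tables≤ {k} {ℓ} wide W²≤G {ℓ} ℕₚ.≤-refl)) scarce))) size≤s
    where
    S : Fin s → Vec Bool (2 ^ k)
    S i = proj₁ (affine-on-instances (g i))
    negated : Fin s → Bool
    negated i = proj₁ (proj₂ (affine-on-instances (g i)))
    open Adversary S negated
    eval≡φ : ∀ t → eval F t ≡ φ (instance-string t)
    eval≡φ t = sym (trans (φ≡ (instance-string t)) (evalFormula-cong F (λ i → proj₂ (proj₂ (affine-on-instances (g i))) t)))
    spec : ∀ t → eval F t ≡ true ⇔ CircuitComplexity≤ (fromTruthTable k t) ℓ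
    spec t = subst (λ v → v ≡ true ⇔ CircuitComplexity≤ (fromTruthTable k t) ℓ) (sym (eval≡φ t))
      (mcsp (instance-string t) k t ℓ p (toList-instance-string t))
    -- Orthogonality of `χ t` and `χ u` on `R` means that `χ (t ⊕ u)` sums to zero, so the generator
    -- has to fool the sums of two elements of the ball.
    sums : List (Vec Bool (2 ^ k))
    sums = cartesianProductWith _⊕_ (ball d) (ball d)
    fooling : ∃[ Bs ] (∀ {u} → u ∈ sums → u ≢ 𝟘 → ∑ (generator {k} {suc k} {b} Bs) (χ u) ≡ 0ℤ)
    fooling = fooling-generator k b sums (subst (_< 2 ^ b)
      (sym (trans (length-cartesian _⊕_ (ball d) (ball d)) (cong₂ _*_ (length-ball S negated d) (length-ball S negated d)))) few-sums)
    Bs : Vec (Block {k} {suc k}) b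
    Bs = proj₁ fooling
    R : List (Vec Bool (2 ^ k))
    R = generator Bs
    orthogonal : Orthogonal R (inBall d)
    orthogonal t u t∈ u∈ t≢u = trans (∑-cong R (λ x → sym (χ-⊕ˡ t u x)))
      (proj₂ fooling (∈-cartesianProductWith⁺ _⊕_ (inBall⇒∈ d t t∈) (inBall⇒∈ d u u∈)) (t≢u ∘ ⊕≡𝟘⇒≡ t u))
    accepts : All (λ a → eval F a ≡ true) R
    accepts = All.tabulate λ {a} a∈ → Equivalence.from (spec a) (relax (generator-complexity Bs a∈))
      where
      relax : ∀ {f} → CircuitComplexity≤ {k} f (b * block-cost {k} (suc k)) → CircuitComplexity≤ f ℓ
      relax (m , m≤ , C , eq) = m , ℕₚ.≤-trans m≤ cheap , C , eq

-- Choice of parameters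

binary-magnitude : ∀ N → 1 ≤ N → ∃[ j ] 2 ^ j ≤ N × N < 2 ^ suc j
binary-magnitude 1 _ = 0 , s≤s z≤n , s≤s (s≤s z≤n)
binary-magnitude (suc N@(suc _)) _ with j , lower , upper ← binary-magnitude N (s≤s z≤n)
  with ℕₚ.m≤n⇒m<n∨m≡n upper
... | inj₁ lt = j , ℕₚ.m≤n⇒m≤1+n lower , lt
... | inj₂ eq = suc j , ℕₚ.≤-reflexive (sym eq) , subst (_< 2 ^ suc (suc j)) (sym eq)
                  (ℕₚ.^-monoʳ-< 2 (s≤s (s≤s z≤n)) (ℕₚ.n<1+n (suc j)))

module _ {k : ℕ} (1≤k : 1 ≤ k) where

  private
    c : ℕ
    c = k * k * k

  1≤k² : 1 ≤ k * k
  1≤k² = ℕₚ.*-mono-≤ 1≤k 1≤k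

  1≤c : 1 ≤ c
  1≤c = ℕₚ.*-mono-≤ 1≤k² 1≤k

  block-cost≤ : block-cost {k} (suc k) ≤ 38 * c
  block-cost≤ = begin
    4 + (suc k * 4 + k * (suc k * (5 + suc k * 4)))
      ≤⟨ ℕₚ.+-monoʳ-≤ 4 (ℕₚ.+-mono-≤ (ℕₚ.*-monoˡ-≤ 4 sk≤) (ℕₚ.*-monoʳ-≤ k (ℕₚ.*-mono-≤ sk≤ (ℕₚ.+-monoʳ-≤ 5 (ℕₚ.*-monoˡ-≤ 4 sk≤))))) ⟩
    4 + ((k + k) * 4 + k * ((k + k) * (5 + (k + k) * 4)))
      ≡⟨ expand k ⟩
    4 * 1 + 8 * k + 10 * (k * k) + 16 * (k * k * k)
      ≤⟨ ℕₚ.+-monoˡ-≤ (16 * c) (ℕₚ.+-mono-≤ (ℕₚ.+-mono-≤ (ℕₚ.*-monoʳ-≤ 4 1≤c) (ℕₚ.*-monoʳ-≤ 8 k≤c)) (ℕₚ.*-monoʳ-≤ 10 k²≤c)) ⟩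
    4 * c + 8 * c + 10 * c + 16 * c
      ≡⟨ collect c ⟩
    38 * c ∎
    where
    open ℕₚ.≤-Reasoning
    sk≤ : suc k ≤ k + k
    sk≤ = ℕₚ.+-monoˡ-≤ k 1≤k
    k²≤c : k * k ≤ c
    k²≤c = ℕₚ.m≤m*n (k * k) k {{>-nonZero 1≤k}}
    k≤c : k ≤ c
    k≤c = ℕₚ.≤-trans (ℕₚ.m≤m*n k k {{>-nonZero 1≤k}}) k²≤c
    expand : ∀ k → 4 + ((k + k) * 4 + k * ((k + k) * (5 + (k + k) * 4))) ≡ 4 * 1 + 8 * k + 10 * (k * k) + 16 * (k * k * k)
    expand = solve-∀ℕ
    collect : ∀ c → 4 * c + 8 * c + 10 * c + 16 * c ≡ 38 * c
    collect = solve-∀ℕ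

  module _ {d : ℕ} (1≤d : 1 ≤ d) where

    -- For `suc s ≤ 2 ^ (k + 2 + (k + 2))` the exponent without `suc` bounds the logarithm of the
    -- number of sums to be fooled; the additional block makes the inequality in `few-sums` strict.
    blocks : ℕ
    blocks = suc ((k + 2 + (k + 2)) * (d + d))

    -- The size threshold is the cost of the generator, which makes all its outputs yes-instances.
    ℓ : ℕ
    ℓ = blocks * block-cost {k} (suc k)

    blocks≤ : blocks ≤ 13 * (k * d)
    blocks≤ = begin
      1 + (k + 2 + (k + 2)) * (d + d)
        ≤⟨ ℕₚ.+-mono-≤ (ℕₚ.*-mono-≤ 1≤k 1≤d) (ℕₚ.*-monoˡ-≤ (d + d) (ℕₚ.+-mono-≤ k+2≤ k+2≤)) ⟩
      k * d + (3 * k + 3 * k) * (d + d)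
        ≡⟨ collect k d ⟩
      13 * (k * d) ∎
      where
      open ℕₚ.≤-Reasoning
      k+2≤ : k + 2 ≤ 3 * k
      k+2≤ = ℕₚ.+-monoʳ-≤ k (ℕₚ.+-mono-≤ 1≤k (ℕₚ.+-mono-≤ 1≤k (z≤n {0})))
      collect : ∀ k d → k * d + (3 * k + 3 * k) * (d + d) ≡ 13 * (k * d)
      collect = solve-∀ℕ

    -- With 2 ^ k wires there are at most 2 ^ (2 * k + 2) choices of a gate, so the
    -- left-hand side bounds the logarithm of twice the number of easy tables.
    threshold≤ : 1 + (2 * k + 2) * suc ℓ ≤ 1981 * (k * k * c * d)
    threshold≤ = begin
      1 + (2 * k + 2) * (1 + ℓ)
        ≤⟨ ℕₚ.+-monoʳ-≤ 1 (ℕₚ.*-mono-≤ (ℕₚ.+-monoʳ-≤ (2 * k) (ℕₚ.*-monoʳ-≤ 2 1≤k)) (ℕₚ.+-mono-≤ 1≤X (ℕₚ.*-mono-≤ blocks≤ block-cost≤))) ⟩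
      1 + (2 * k + 2 * k) * (k * d * c + 13 * (k * d) * (38 * c))
        ≤⟨ ℕₚ.+-monoˡ-≤ _ (ℕₚ.*-mono-≤ 1≤k 1≤X) ⟩
      k * (k * d * c) + (2 * k + 2 * k) * (k * d * c + 13 * (k * d) * (38 * c))
        -- The constant arises as 1981 = 1 + 4 · (1 + 13 · 38).
        ≡⟨ collect k d c ⟩
      1981 * (k * k * c * d) ∎
      where
      open ℕₚ.≤-Reasoning
      1≤X : 1 ≤ k * d * c
      1≤X = ℕₚ.*-mono-≤ (ℕₚ.*-mono-≤ 1≤k 1≤d) 1≤c
      collect : ∀ k d c → k * (k * d * c) + (2 * k + 2 * k) * (k * d * c + 13 * (k * d) * (38 * c)) ≡ 1981 * (k * k * c * d)
      collect = solve-∀ℕ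

    module _ (threshold : 1 + (2 * k + 2) * suc ℓ ≤ 2 ^ k) where

      -- Serves twice: `2 ^ k` bounds the number of wires, and the encoding around the table is no
      -- longer than the table.
      room : 2 + (k + ℓ) ≤ 2 ^ k
      room = ℕₚ.≤-trans (ℕₚ.m≤m+n (2 + (k + ℓ)) (1 + (k + ℓ + 2 * (k * ℓ)))) (ℕₚ.≤-trans (ℕₚ.≤-reflexive (expand k ℓ)) threshold)
        where
        expand : ∀ k ℓ → (2 + (k + ℓ)) + (1 + (k + ℓ + 2 * (k * ℓ))) ≡ 1 + (2 * k + 2) * suc ℓ
        expand = solve-∀ℕ

      gate-choices : 2 ^ k * 2 ^ k + (2 ^ k * 2 ^ k + 2 ^ k) ≤ 2 ^ (2 * k + 2)
      gate-choices = begin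
        W * W + (W * W + W)         ≤⟨ ℕₚ.+-monoʳ-≤ (W * W) (ℕₚ.+-monoʳ-≤ (W * W) (ℕₚ.m≤m*n W W {{ℕₚ.m^n≢0 2 k}})) ⟩
        W * W + (W * W + W * W)     ≤⟨ ℕₚ.m≤m+n _ (W * W) ⟩
        W * W + (W * W + W * W) + W * W ≡⟨ four W ⟩
        W * (W + 0) * 4             ≡⟨ cong (_* 4) (trans (cong (W *_) (ℕₚ.+-identityʳ W)) (sym (trans (cong (λ m → 2 ^ (k + m)) (ℕₚ.+-identityʳ k)) (ℕₚ.^-distribˡ-+-* 2 k k)))) ⟩
        2 ^ (2 * k) * 4             ≡⟨ sym (ℕₚ.^-distribˡ-+-* 2 (2 * k) 2) ⟩
        2 ^ (2 * k + 2)             ∎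
        where
        open ℕₚ.≤-Reasoning
        W : ℕ
        W = 2 ^ k
        four : ∀ W → W * W + (W * W + W * W) + W * W ≡ W * (W + 0) * 4
        four = solve-∀ℕ

      scarce : 2 * (2 ^ (2 * k + 2)) ^ suc ℓ ≤ 2 ^ (2 ^ k)
      scarce = ℕₚ.≤-trans (ℕₚ.≤-reflexive (cong (2 *_) (ℕₚ.^-*-assoc 2 (2 * k + 2) (suc ℓ)))) (ℕₚ.^-monoʳ-≤ 2 threshold)

      few-sums : ∀ {s} → suc s ≤ 2 ^ (k + 2 + (k + 2)) → suc s ^ d * suc s ^ d < 2 ^ blocks
      few-sums {s} s< = ℕₚ.≤-<-trans
        (ℕₚ.≤-trans (ℕₚ.≤-reflexive (sym (ℕₚ.^-distribˡ-+-* (suc s) d d)))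
          (ℕₚ.≤-trans (ℕₚ.^-monoˡ-≤ (d + d) s<) (ℕₚ.≤-reflexive (ℕₚ.^-*-assoc 2 (k + 2 + (k + 2)) (d + d)))))
        (ℕₚ.^-monoʳ-< 2 (s≤s (s≤s z≤n)) (ℕₚ.n<1+n ((k + 2 + (k + 2)) * (d + d))))

      quadratic : ∀ {N s} {φ : Vec Bool N → Bool} → 2 * 2 ^ k ≤ N → suc s ≤ 2 ^ (k + 2 + (k + 2)) →
        FORMULA[ s ]∘XOR φ → ComputesMCSP φ → 2 * (d * d) ≤ s
      quadratic {N} {s} {φ} large s< = go N (sym N≡) φ
        where
        fits : k + suc (2 ^ k + ℓ) ≤ N
        fits = ℕₚ.≤-trans (ℕₚ.≤-reflexive (shuffle k (2 ^ k) ℓ))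
          (ℕₚ.≤-trans (ℕₚ.+-mono-≤ (ℕₚ.≤-trans (ℕₚ.n≤1+n _) room) (ℕₚ.m≤m+n (2 ^ k) 0)) large)
          where
          shuffle : ∀ k n ℓ → k + suc (n + ℓ) ≡ suc (k + ℓ) + n
          shuffle = solve-∀ℕ
        -- All bits of the input beyond the instance itself become padding.
        p : ℕ
        p = N ∸ (k + suc (2 ^ k + ℓ))
        N≡ : instance-length k ℓ p ≡ N
        N≡ = trans (shuffle k (2 ^ k) ℓ p) (ℕₚ.m+[n∸m]≡n fits)
          where
          shuffle : ∀ k n ℓ p → k + suc (n + (ℓ + p)) ≡ k + suc (n + ℓ) + p
          shuffle = solve-∀ℕ
        go : ∀ N → N ≡ instance-length k ℓ p → (φ : Vec Bool N → Bool) → FORMULA[ s ]∘XOR φ → ComputesMCSP φ → 2 * (d * d) ≤ s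
        go _ refl φ formula mcsp = MCSP-bound k ℓ p {d = d} {b = blocks} {W = 2 ^ k} {G = 2 ^ (2 * k + 2)} formula mcsp (few-sums s<) ℕₚ.≤-refl room gate-choices scarce

module _ {e : ℕ} (large-e : 1981 ≤ e) {k : ℕ} (1≤k : 1 ≤ k) where

  private
    -- The polylogarithmic loss, with `k` about log N: the choice `d = 2 ^ k / E` satisfies the
    -- threshold condition, by `threshold≤` and `1981 ≤ e`.
    E : ℕ
    E = e * (k * k * (k * k * k))

    1≤E : 1 ≤ E
    1≤E = ℕₚ.*-mono-≤ (ℕₚ.≤-trans (s≤s z≤n) large-e) (ℕₚ.*-mono-≤ (1≤k² 1≤k) (1≤c 1≤k))

    instance
      E≢0 : NonZero E
      E≢0 = >-nonZero 1≤E

  n<E*[1+n/E] : ∀ n → n < E * suc (n / E)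
  n<E*[1+n/E] n = begin-strict
    n                     ≡⟨ m≡m%n+[m/n]*n n E ⟩
    n % E + n / E * E     <⟨ ℕₚ.+-monoˡ-< (n / E * E) (m%n<n n E) ⟩
    E + n / E * E         ≡⟨ ℕₚ.*-comm (suc (n / E)) E ⟩
    E * suc (n / E)       ∎
    where open ℕₚ.≤-Reasoning

  -- Rounding in the division costs `suc D` in place of `D`, hence a factor 2: N is at most 8 E D,
  -- and 64 is the square of 8.
  square-bound : ∀ {N s D} → 1 ≤ D → N ≤ 4 * (E * suc D) → D * D ≤ s → N * N ≤ s * (64 * (E * E))
  square-bound {N} {s} {D} 1≤D N≤ D²≤s = begin
    N * N                                           ≤⟨ ℕₚ.*-mono-≤ N≤′ N≤′ ⟩
    4 * (E * (D + D)) * (4 * (E * (D + D)))         ≡⟨ collect E D ⟩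
    D * D * (64 * (E * E))                          ≤⟨ ℕₚ.*-monoˡ-≤ (64 * (E * E)) D²≤s ⟩
    s * (64 * (E * E))                              ∎
    where
    open ℕₚ.≤-Reasoning
    N≤′ : N ≤ 4 * (E * (D + D))
    N≤′ = ℕₚ.≤-trans N≤ (ℕₚ.*-monoʳ-≤ 4 (ℕₚ.*-monoʳ-≤ E (ℕₚ.+-monoˡ-≤ D 1≤D)))
    collect : ∀ E D → 4 * (E * (D + D)) * (4 * (E * (D + D))) ≡ D * D * (64 * (E * E))
    collect = solve-∀ℕ

  quadratic-bound : ∀ {N s} {φ : Vec Bool N → Bool} → 2 * 2 ^ k ≤ N → N ≤ 4 * 2 ^ k →
    FORMULA[ s ]∘XOR φ → ComputesMCSP φ → N * N ≤ s * (64 * (E * E))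
  quadratic-bound {N} {s} lower upper formula@(F , _ , size≤s , _) mcsp with ℕₚ.<-≤-connex s (N * N)
  -- A formula this large meets the bound already. The other case supplies `suc s ≤ N * N`, from
  -- which the number of blocks is justified.
  ... | inj₂ N²≤s = ℕₚ.≤-trans N²≤s (ℕₚ.m≤m*n s (64 * (E * E)) {{>-nonZero (ℕₚ.*-mono-≤ (s≤s (z≤n {63})) (ℕₚ.*-mono-≤ 1≤E 1≤E))}})
  ... | inj₁ s<N² with 2 ^ k / E in d≡
  -- Here `2 ^ k` is below `E`, and it is enough that a formula has at least one leaf.
  ...   | zero  = square-bound {D = 1} ℕₚ.≤-refl
                    (ℕₚ.≤-trans upper (ℕₚ.*-monoʳ-≤ 4 (ℕₚ.≤-trans (ℕₚ.<⇒≤ (subst (λ d → 2 ^ k < E * suc d) d≡ (n<E*[1+n/E] (2 ^ k)))) (ℕₚ.*-monoʳ-≤ E (s≤s z≤n)))))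
                    (ℕₚ.≤-trans (size-pos F) size≤s)
  ...   | suc d = square-bound {D = suc d} (s≤s z≤n)
                    (ℕₚ.≤-trans upper (ℕₚ.*-monoʳ-≤ 4 (ℕₚ.<⇒≤ (subst (λ d → 2 ^ k < E * suc d) d≡ (n<E*[1+n/E] (2 ^ k))))))
                    (ℕₚ.≤-trans (ℕₚ.m≤m+n (suc d * suc d) _) (quadratic 1≤k {suc d} (s≤s z≤n) threshold lower s< formula mcsp))
    where
    threshold : 1 + (2 * k + 2) * suc (ℓ 1≤k {suc d} (s≤s z≤n)) ≤ 2 ^ k
    threshold = begin
      1 + (2 * k + 2) * suc (ℓ 1≤k {suc d} (s≤s z≤n))  ≤⟨ threshold≤ 1≤k (s≤s z≤n) ⟩
      1981 * (k * k * (k * k * k) * suc d)              ≤⟨ ℕₚ.*-monoˡ-≤ (k * k * (k * k * k) * suc d) large-e ⟩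
      e * (k * k * (k * k * k) * suc d)                 ≡⟨ trans (sym (ℕₚ.*-assoc e (k * k * (k * k * k)) (suc d))) (ℕₚ.*-comm E (suc d)) ⟩
      suc d * E                                         ≡⟨ cong (_* E) (sym d≡) ⟩
      2 ^ k / E * E                                     ≤⟨ m/n*n≤m (2 ^ k) E ⟩
      2 ^ k                                             ∎
      where open ℕₚ.≤-Reasoning
    N≤ : N ≤ 2 ^ (k + 2)
    N≤ = ℕₚ.≤-trans upper (ℕₚ.≤-reflexive (trans (ℕₚ.*-comm 4 (2 ^ k)) (sym (ℕₚ.^-distribˡ-+-* 2 k 2))))
    s< : suc s ≤ 2 ^ (k + 2 + (k + 2))
    s< = ℕₚ.≤-trans s<N² (ℕₚ.≤-trans (ℕₚ.*-mono-≤ N≤ N≤) (ℕₚ.≤-reflexive (sym (ℕₚ.^-distribˡ-+-* 2 (k + 2) (k + 2)))))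

  polylog-bound : ∀ {N s} → k ≤ ⌊log₂ N ⌋ → N * N ≤ s * (64 * (E * E)) → N ^ 2 ≤ s * (64 * (e * e) * ⌊log₂ N ⌋ ^ 10)
  polylog-bound {N} {s} k≤log le = begin
    N * (N * 1)                                ≡⟨ cong (N *_) (ℕₚ.*-identityʳ N) ⟩
    N * N                                      ≤⟨ le ⟩
    -- `E` contains the fifth power of `k`, whence the exponent 10.
    s * (64 * (E * E))                         ≡⟨ cong (s *_) (regroup e k) ⟩
    s * (64 * (e * e) * k ^ 10)                ≤⟨ ℕₚ.*-monoʳ-≤ s (ℕₚ.*-monoʳ-≤ (64 * (e * e)) (ℕₚ.^-monoˡ-≤ 10 k≤log)) ⟩
    s * (64 * (e * e) * ⌊log₂ N ⌋ ^ 10)        ∎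
    where
    open ℕₚ.≤-Reasoning
    regroup : ∀ e k → 64 * (e * (k * k * (k * k * k)) * (e * (k * k * (k * k * k)))) ≡ 64 * (e * e) * (k * (k * (k * (k * (k * (k * (k * (k * (k * (k * 1))))))))))
    regroup = solve-∀ℕ

size-lower-bound : ∀ {e} → 1981 ≤ e → ∀ {N s} {φ : Vec Bool N → Bool} → 4 ≤ N →
  FORMULA[ s ]∘XOR φ → ComputesMCSP φ → N ^ 2 ≤ s * (64 * (e * e) * ⌊log₂ N ⌋ ^ 10)
size-lower-bound large-e {N} {s} 4≤N formula mcsp with binary-magnitude N (ℕₚ.≤-trans (s≤s z≤n) 4≤N)
-- If `2 ^ j` is the largest power of two up to `N`, the tables get length 2^(j-1), at most half of
-- the input. Ruling out j < 2 keeps the number of variables positive.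
... | 0 , _ , upper = ⊥-elim (ℕₚ.<⇒≱ upper (ℕₚ.≤-trans (s≤s (s≤s z≤n)) 4≤N))
... | 1 , _ , upper = ⊥-elim (ℕₚ.<⇒≱ upper 4≤N)
... | suc (suc k) , lower , upper =
  polylog-bound large-e {suc k} (s≤s z≤n) {N} {s} (ℕₚ.≤-trans (ℕₚ.n≤1+n (suc k)) j≤log)
    (quadratic-bound large-e {suc k} (s≤s z≤n) lower (ℕₚ.≤-trans (ℕₚ.<⇒≤ upper) (ℕₚ.≤-reflexive (sym (ℕₚ.*-assoc 2 2 (2 ^ suc k))))) formula mcsp)
  where
  j≤log : suc (suc k) ≤ ⌊log₂ N ⌋
  j≤log = subst (_≤ ⌊log₂ N ⌋) (⌊log₂[2^n]⌋≡n (suc (suc k))) (⌊log₂⌋-mono-≤ lower)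

theorem4p10 : ∃[ c ] ∃[ d ] ∃[ N₀ ]
    (∀ (N : ℕ) → N₀ ≤ N →
    ∀ (s : ℕ) (φ : Vec Bool N → Bool) →
    FORMULA[ s ]∘XOR φ → ComputesMCSP φ →
    N ^ 2 ≤ s * (c * ⌊log₂ N ⌋ ^ d))
theorem4p10 = 64 * (1981 * 1981) , 10 , 4 ,
  λ N 4≤N s φ formula mcsp → size-lower-bound {1981} ℕₚ.≤-refl 4≤N formula mcsp
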